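{- Let $H$ be a fixed bipartite graph with $B > 2$ vertices. Then there is a constant $c = c(H) > 0$ (independent of $n$ and $d$) such that for all integers $n \ge 1$ and $d \ge 1$, every $n$-vertex $d$-regular graph $G$ that does not contain $H$ as a (not necessarily induced) subgraph contains an induced matching of size at least $c \cdot \frac{n}{d}\log d$. In asymptotic notation: such a $G$ contains an induced matching of size $\Omega\!\left(\frac{n}{d}\log d\right)$.
   Context: All graphs are finite, simple and undirected. An induced matching in a graph $G$ is a matching $M$ (a set of pairwise vertex-disjoint edges) such that no edge of $G$ joins an endpoint of one edge of $M$ to an endpoint of a different edge of $M$. The implied constant in $\Omega$ may depend on $H$ but not on $n$ or $d$. -}

module Defs where

open import Data.Nat using (ℕ; _+_)
open import Data.Bool using (Bool; true; false; if_then_else_)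
open import Data.Fin using (Fin)
open import Data.List using (map; allFin)
open import Data.Nat.ListAction using (sum)
open import Data.Product using (Σ; _×_; proj₁; proj₂)
open import Relation.Binary.PropositionalEquality using (_≡_; _≢_)
open import Relation.Nullary using (¬_)
open import Function.Definitions using (Injective)

record Graph (n : ℕ) : Set where
  field
    adj    : Fin n → Fin n → Bool
    sym    : ∀ u v → adj u v ≡ adj v u
    irrefl : ∀ v → adj v v ≡ false
open Graph public

degree : ∀ {n} → Graph n → Fin n → ℕ
degree {n} G v = sum (map (λ w → if adj G v w then 1 else 0) (allFin n))

Regular : ∀ {n} → Graph n → ℕ → Set
Regular {n} G d = ∀ v → degree G v ≡ d

IsBipartite : ∀ {n} → Graph n → Set
IsBipartite {n} H = Σ (Fin n → Bool) λ f → ∀ (u v : Fin n) → adj H u v ≡ true → f u ≢ f v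

ContainsSubgraph : ∀ {n m} → Graph n → Graph m → Set
ContainsSubgraph {n} {m} G H =
  Σ (Fin m → Fin n) λ φ →
    Injective _≡_ _≡_ φ × (∀ (u v : Fin m) → adj H u v ≡ true → adj G (φ u) (φ v) ≡ true)

end : ∀ {n} → Fin n × Fin n → Bool → Fin n
end e true  = proj₁ e
end e false = proj₂ e

IsInducedMatching : ∀ {n k} → Graph n → (Fin k → Fin n × Fin n) → Set
IsInducedMatching {n} {k} G e =
  (∀ i → adj G (proj₁ (e i)) (proj₂ (e i)) ≡ true) ×
  (∀ i j → i ≢ j → ∀ (a b : Bool) →
     (end (e i) a ≢ end (e j) b) × (adj G (end (e i) a) (end (e j) b) ≡ false))

HasInducedMatchingOfSize : ∀ {n} → Graph n → ℕ → Set
HasInducedMatchingOfSize {n} G k = Σ (Fin k → Fin n × Fin n) λ e → IsInducedMatching G e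

{-# OPTIONS --safe #-}
module Submission where

-- Take a maximal matching M of G; it has at least n/4 edges.  Its conflict graph (two edges of M
-- conflict when G joins them) has maximum degree at most D = 4d, and an independent set in it is an
-- induced matching of G.  By a Kővári–Sós–Turán argument every neighbourhood of the conflict graph
-- spans only O(d²/r) edges, where r is a small power of d.  In the hard-core model on such a graph,
-- with fugacity about a small power of d over d, let x be the number of neighbours u of v that have
-- no occupied neighbour outside the closed neighbourhood of v.  If x is small then v itself is
-- occupied with good probability, and if x is large then local sparsity forces many occupied
-- neighbours of v.  Either way D · P(v occupied) + E(occupied neighbours of v) is at least of order
-- log d, and summing over v gives an independent set of size of order |M| log d / d.

open import Defs hiding (sym)
open import Data.Bool using (Bool; true; false; _∧_; _∨_; not; if_then_else_)
open import Data.Bool.Properties using (¬-not; ∨-zeroʳ; ∨-comm; ∧-zeroʳ; ∧-identityʳ) renaming (_≟_ to _≟ᵇ_)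
open import Data.Fin using (Fin; zero; suc)
open import Data.Fin.Properties using (_≟_; suc-injective; all?; any?; ¬∀⟶∃¬)
open import Data.List using (List; []; _∷_; map; tabulate; allFin; cartesianProduct)
open import Data.List.Membership.Propositional.Properties using (∈-cartesianProduct⁺; ∈-allFin)
open import Data.List.Properties using (map-cong)
open import Data.List.Relation.Unary.All as All using (All; []; _∷_)
open import Data.List.Relation.Unary.All.Properties using () renaming (tabulate⁺ to tabulateAll)
open import Data.List.Relation.Unary.AllPairs using ([]; _∷_)
open import Data.List.Relation.Unary.Unique.Propositional using (Unique)
open import Data.List.Relation.Unary.Unique.Propositional.Properties using (allFin⁺)
open import Data.Nat hiding (_≟_)
open import Data.Nat.DivMod using (_/_; _%_; m≡m%n+[m/n]*n; m%n<n; m/n*n≤m; m≥n⇒m/n>0; m/n≡0⇒m<n)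
open import Data.Nat.Induction using (<-rec)
import Data.Nat.ListAction as List
open import Data.Nat.Logarithm using (⌊log₂_⌋; ⌊log₂⌊n/2⌋⌋≡⌊log₂n⌋∸1)
open import Data.Nat.Properties hiding (_≟_; suc-injective)
open import Data.Nat.Tactic.RingSolver using (solve-∀)
open import Data.Product using (Σ; ∃; _×_; _,_; proj₁; proj₂; map₂)
open import Data.Sum using (_⊎_; inj₁; inj₂) renaming (map to map-⊎)
open import Data.Vec using (Vec; []; _∷_; lookup; replicate; _[_]≔_)
open import Data.Vec.Properties using (lookup∘update; lookup∘update′; lookup-replicate)
open import Function using (_∘_; id; mk⇔)
open import Function.Definitions using (Injective)
open import Relation.Binary.PropositionalEquality
open import Relation.Nullary using (Dec; yes; no; does; contradiction; ¬_)
open import Relation.Nullary.Decidable using (dec-true; dec-false; does-⇔; _→-dec_; _⊎-dec_)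
open import Algebra.Properties.Semiring.Sum +-*-semiring
  using (sum; sum-syntax; sum-cong-≗; ∑-distrib-+; ∑-comm; *-distribˡ-sum; *-distribʳ-sum)

-- Why a matching first: its edges have pairwise distinct ends, so each of the four end-to-end
-- relations between its edges copies part of the adjacency of G. Conflict degrees are then linear
-- in d, and a biclique in one of these relations is a biclique of G, where H can be placed. Where
-- the logarithm comes from: let the fugacity be 1/(m - 1) with m = 2k. If fewer than kj neighbours
-- of v are available, v has no occupied neighbour with conditional probability at least (1 -
-- 1/m)^(kj), which is at least 2^(-j); hence D · P(v occupied) has order j as soon as k j 2^j is at
-- most D. If at least kj are available, about kj/m = j/2 of them are occupied on average, up to an
-- error that is absorbed when the local edge count is at most k²j. Taking k near d/4^j satisfies
-- both demands while j is a small multiple of log d; H only influences how small. A fugacity of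
-- order 1/d would give j bounded and no gain.

⟦_⟧ : Bool → ℕ
⟦ b ⟧ = if b then 1 else 0

⟦⟧≤1 : ∀ b → ⟦ b ⟧ ≤ 1
⟦⟧≤1 true  = ≤-refl
⟦⟧≤1 false = z≤n

⟦⟧-mono : ∀ {a b} → (a ≡ true → b ≡ true) → ⟦ a ⟧ ≤ ⟦ b ⟧
⟦⟧-mono {false} f = z≤n
⟦⟧-mono {true}  f rewrite f refl = ≤-refl

⟦∧⟧ : ∀ a b → ⟦ a ∧ b ⟧ ≡ ⟦ a ⟧ * ⟦ b ⟧
⟦∧⟧ true  b = sym (+-identityʳ ⟦ b ⟧)
⟦∧⟧ false b = refl

⟦dec⟧-mono : ∀ {P Q : Set} (P? : Dec P) (Q? : Dec Q) → (P → Q) → ⟦ does P? ⟧ ≤ ⟦ does Q? ⟧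
⟦dec⟧-mono (yes p) Q? f rewrite dec-true Q? (f p) = ≤-refl
⟦dec⟧-mono (no _)  Q? f = z≤n

-- Finite sums, counting and injections.

∑-mono : ∀ {n} {f g : Fin n → ℕ} → (∀ i → f i ≤ g i) → sum f ≤ sum g
∑-mono {zero}  h = z≤n
∑-mono {suc n} h = +-mono-≤ (h zero) (∑-mono (h ∘ suc))

∑-const : ∀ n c → ∑[ _ < n ] c ≡ n * c
∑-const zero    c = refl
∑-const (suc n) c = cong (c +_) (∑-const n c)

term≤∑ : ∀ {n} (f : Fin n → ℕ) i → f i ≤ sum f
term≤∑ f zero    = m≤m+n _ _
term≤∑ f (suc i) = ≤-trans (term≤∑ (f ∘ suc) i) (m≤n+m _ _)

∑-<⇒∃ : ∀ {n} (f g : Fin n → ℕ) → sum f < sum g → ∃ λ i → f i < g i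
∑-<⇒∃ {suc n} f g lt with f zero <? g zero
... | yes p = zero , p
... | no ¬p with ∑-<⇒∃ (f ∘ suc) (g ∘ suc)
                   (+-cancelˡ-< (f zero) _ _ (<-≤-trans lt (+-monoˡ-≤ _ (≮⇒≥ ¬p))))
...   | i , q = suc i , q

∑⟦⟧≤1 : ∀ {n} (b : Fin n → Bool) → (∀ i j → b i ≡ true → b j ≡ true → i ≡ j) →
        ∑[ i < n ] ⟦ b i ⟧ ≤ 1
∑⟦⟧≤1 {zero}  b u = z≤n
∑⟦⟧≤1 {suc n} b u with b zero in eq
... | false = ∑⟦⟧≤1 (b ∘ suc) λ i j p q → suc-injective (u (suc i) (suc j) p q)
... | true  = ≤-reflexive (cong suc (trans (sum-cong-≗ vanish) (trans (∑-const n 0) (*-zeroʳ n))))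
  where
  vanish : ∀ i → ⟦ b (suc i) ⟧ ≡ 0
  vanish i with b (suc i) in eq′
  ... | false = refl
  ... | true with u zero (suc i) eq eq′
  ...   | ()

does-≟-refl : ∀ {n} (i : Fin n) → does (i ≟ i) ≡ true
does-≟-refl i = dec-true (i ≟ i) refl

does⇒ : ∀ {P : Set} (P? : Dec P) → does P? ≡ true → P
does⇒ (yes p) _ = p

∑-injective : ∀ {m n} (φ : Fin m → Fin n) → Injective _≡_ _≡_ φ → (f : Fin n → ℕ) →
              sum (f ∘ φ) ≤ sum f
∑-injective {m} {n} φ inj f = begin
  ∑[ j < m ] f (φ j)                                   ≤⟨ ∑-mono pick ⟩
  ∑[ j < m ] ∑[ w < n ] (f w * ⟦ does (φ j ≟ w) ⟧)     ≡⟨ ∑-comm (λ j w → f w * ⟦ does (φ j ≟ w) ⟧) ⟩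
  ∑[ w < n ] ∑[ j < m ] (f w * ⟦ does (φ j ≟ w) ⟧)
    ≡⟨ sum-cong-≗ (λ w → *-distribˡ-sum (f w) (λ j → ⟦ does (φ j ≟ w) ⟧)) ⟨
  ∑[ w < n ] (f w * ∑[ j < m ] ⟦ does (φ j ≟ w) ⟧)     ≤⟨ ∑-mono (λ w → *-monoʳ-≤ (f w) (fibre w)) ⟩
  ∑[ w < n ] (f w * 1)                                 ≡⟨ sum-cong-≗ (λ w → *-identityʳ (f w)) ⟩
  sum f                                                ∎
  where
  open ≤-Reasoning
  pick : ∀ j → f (φ j) ≤ ∑[ w < n ] (f w * ⟦ does (φ j ≟ w) ⟧)
  pick j = ≤-trans
    (≤-reflexive (sym (trans (cong (λ b → f (φ j) * ⟦ b ⟧) (does-≟-refl (φ j))) (*-identityʳ _))))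
             (term≤∑ (λ w → f w * ⟦ does (φ j ≟ w) ⟧) (φ j))
  fibre : ∀ w → ∑[ j < m ] ⟦ does (φ j ≟ w) ⟧ ≤ 1
  fibre w = ∑⟦⟧≤1 _ λ i j p q → inj (trans (does⇒ (φ i ≟ w) p) (sym (does⇒ (φ j ≟ w) q)))

enumerate : ∀ {n} (χ : Fin n → Bool) {t} → t ≤ ∑[ i < n ] ⟦ χ i ⟧ →
            Σ (Fin t → Fin n) λ φ → Injective _≡_ _≡_ φ × (∀ i → χ (φ i) ≡ true)
enumerate χ {zero} _ = (λ ()) , (λ { {()} }) , λ ()
enumerate {suc n} χ {suc t} h with χ zero in eq
... | false with enumerate (χ ∘ suc) h
...   | φ , inj , on = suc ∘ φ , inj ∘ suc-injective , on
enumerate {suc n} χ {suc t} (s≤s h) | true with enumerate (χ ∘ suc) h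
... | φ , inj , on = ψ , ψ-inj , λ { zero → eq ; (suc i) → on i }
  where
  ψ : Fin (suc t) → Fin (suc n)
  ψ zero    = zero
  ψ (suc i) = suc (φ i)
  ψ-inj : Injective _≡_ _≡_ ψ
  ψ-inj {zero}  {zero}  _  = refl
  ψ-inj {suc i} {suc j} eq = cong suc (inj (suc-injective eq))

-- The weight of a configuration is q to the number of its unoccupied coordinates, so that each
-- coordinate is occupied with fugacity 1 / q while all expectations remain natural numbers.
module Weighted (q : ℕ) where

  E : ∀ {n} → (Vec Bool n → ℕ) → ℕ
  E {zero}  F = F []
  E {suc n} F = E λ I → q * F (false ∷ I) + F (true ∷ I)

  E-mono : ∀ {n} {F G : Vec Bool n → ℕ} → (∀ I → F I ≤ G I) → E F ≤ E G
  E-mono {zero}  h = h []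
  E-mono {suc n} h = E-mono {n} λ I → +-mono-≤ (*-monoʳ-≤ q (h (false ∷ I))) (h (true ∷ I))

  E-cong : ∀ {n} {F G : Vec Bool n → ℕ} → (∀ I → F I ≡ G I) → E F ≡ E G
  E-cong {zero}  h = h []
  E-cong {suc n} h = E-cong {n} λ I → cong₂ _+_ (cong (q *_) (h (false ∷ I))) (h (true ∷ I))

  E-+ : ∀ {n} (F G : Vec Bool n → ℕ) → E (λ I → F I + G I) ≡ E F + E G
  E-+ {zero}  F G = refl
  E-+ {suc n} F G = trans
    (E-cong λ I → regroup q (F (false ∷ I)) (G (false ∷ I)) (F (true ∷ I)) (G (true ∷ I)))
    (E-+ (λ I → q * F (false ∷ I) + F (true ∷ I)) (λ I → q * G (false ∷ I) + G (true ∷ I)))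
    where
    regroup : ∀ q a b c d → q * (a + b) + (c + d) ≡ (q * a + c) + (q * b + d)
    regroup = solve-∀

  E-* : ∀ {n} k (F : Vec Bool n → ℕ) → E (λ I → k * F I) ≡ k * E F
  E-* {zero}  k F = refl
  E-* {suc n} k F = trans
    (E-cong λ I → regroup q k (F (false ∷ I)) (F (true ∷ I)))
    (E-* k (λ I → q * F (false ∷ I) + F (true ∷ I)))
    where
    regroup : ∀ q k a b → q * (k * a) + k * b ≡ k * (q * a + b)
    regroup = solve-∀

  E-zero : ∀ n → E {n} (λ _ → 0) ≡ 0
  E-zero n = E-* {n} 0 (λ _ → 0)

  E-∑ : ∀ {n m} (F : Fin m → Vec Bool n → ℕ) → E (λ I → ∑[ i < m ] F i I) ≡ ∑[ i < m ] E (F i)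
  E-∑ {n} {zero}  F = E-zero n
  E-∑ {n} {suc m} F = trans (E-+ (F zero) _) (cong (E (F zero) +_) (E-∑ (F ∘ suc)))

  -- Conditioning on all coordinates but `u`: the weight is a product, so the hypothesis compares
  -- both sides on each fibre of the map forgetting `u`, with the weights `q` and 1 of its two
  -- points.
  E-resample : ∀ {n} (u : Fin n) (F G : Vec Bool n → ℕ) →
    (∀ I → q * F (I [ u ]≔ false) + F (I [ u ]≔ true) ≤ q * G (I [ u ]≔ false) + G (I [ u ]≔ true)) →
    E F ≤ E G
  E-resample zero    F G h = E-mono λ I → h (false ∷ I)
  E-resample (suc u) F G h = E-resample u _ _ λ I → begin
    q * (q * F (false ∷ (I [ u ]≔ false)) + F (true ∷ (I [ u ]≔ false)))
      + (q * F (false ∷ (I [ u ]≔ true)) + F (true ∷ (I [ u ]≔ true)))   ≡⟨ regroup q _ _ _ _ ⟩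
    q * (q * F (false ∷ (I [ u ]≔ false)) + F (false ∷ (I [ u ]≔ true)))
      + (q * F (true ∷ (I [ u ]≔ false)) + F (true ∷ (I [ u ]≔ true)))
      ≤⟨ +-mono-≤ (*-monoʳ-≤ q (h (false ∷ I))) (h (true ∷ I)) ⟩
    q * (q * G (false ∷ (I [ u ]≔ false)) + G (false ∷ (I [ u ]≔ true)))
      + (q * G (true ∷ (I [ u ]≔ false)) + G (true ∷ (I [ u ]≔ true)))   ≡⟨ regroup q _ _ _ _ ⟨
    q * (q * G (false ∷ (I [ u ]≔ false)) + G (true ∷ (I [ u ]≔ false)))
      + (q * G (false ∷ (I [ u ]≔ true)) + G (true ∷ (I [ u ]≔ true)))   ∎
    where
    open ≤-Reasoning
    regroup : ∀ q a b c d → q * (q * a + b) + (q * c + d) ≡ q * (q * a + c) + (q * b + d)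
    regroup = solve-∀

  E-<⇒∃ : ∀ {n} (F G : Vec Bool n → ℕ) → E F < E G → ∃ λ I → F I < G I
  E-<⇒∃ {zero}  F G lt = [] , lt
  E-<⇒∃ {suc n} F G lt with E-<⇒∃ _ _ lt
  ... | I , p with F (false ∷ I) <? G (false ∷ I) | F (true ∷ I) <? G (true ∷ I)
  ...   | yes r | _     = _ , r
  ...   | _     | yes r = _ , r
  ...   | no ¬r | no ¬s =
    contradiction p (≤⇒≯ (+-mono-≤ (*-monoʳ-≤ q (≮⇒≥ ¬r)) (≮⇒≥ ¬s)))

  E-positive : ∀ {n} .{{_ : NonZero q}} (F : Vec Bool n → ℕ) → 0 < F (replicate n false) → 0 < E F
  E-positive {zero}  F pos = pos
  E-positive {suc n} F pos =
    E-positive {n} _ (≤-trans pos (≤-trans (m≤n*m _ q) (m≤m+n _ _)))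

-- Power estimates and products of two-valued factors.

^-distribʳ-* : ∀ a b n → (a * b) ^ n ≡ a ^ n * b ^ n
^-distribʳ-* a b zero    = refl
^-distribʳ-* a b (suc n) rewrite ^-distribʳ-* a b n = swap a b (a ^ n) (b ^ n)
  where
  swap : ∀ a b x y → a * b * (x * y) ≡ a * x * (b * y)
  swap = solve-∀

-- Bernoulli's inequality (1 - 1/m)^i ≥ 1 - i/m for m = q + 1, with denominators and subtraction
-- cleared.
bernoulli : ∀ q i → suc q * suc q ^ i ≤ suc q * q ^ i + i * suc q ^ i
bernoulli q zero    = m≤m+n _ _
bernoulli q (suc i) = begin
  m * (m * m ^ i)                                ≤⟨ *-monoʳ-≤ m (bernoulli q i) ⟩
  m * (m * q ^ i + i * m ^ i)                    ≡⟨ expand q i (q ^ i) (m ^ i) ⟩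
  m * q ^ i + (m * (q * q ^ i) + i * (m * m ^ i))
    ≤⟨ +-monoˡ-≤ _ (*-monoʳ-≤ m (^-monoˡ-≤ i (n≤1+n q))) ⟩
  m * m ^ i + (m * (q * q ^ i) + i * (m * m ^ i))  ≡⟨ collect (m * m ^ i) (m * (q * q ^ i)) i ⟩
  m * (q * q ^ i) + suc i * (m * m ^ i)          ∎
  where
  open ≤-Reasoning
  m = suc q
  expand : ∀ q i x y → suc q * (suc q * x + i * y) ≡ suc q * x + (suc q * (q * x) + i * (suc q * y))
  expand = solve-∀
  collect : ∀ a b i → a + (b + i * a) ≡ b + suc i * a
  collect = solve-∀

-- Bernoulli with exponent k and m = 2k leaves exactly 1/2. This is why m is kept even throughout.
halving : ∀ q k → suc q ≡ 2 * k → .{{_ : NonZero k}} → suc q ^ k ≤ 2 * q ^ k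
halving q k eq = *-cancelˡ-≤ k (+-cancelʳ-≤ (k * suc q ^ k) _ _ (begin
  k * suc q ^ k + k * suc q ^ k      ≡⟨ twice k (suc q ^ k) ⟩
  2 * k * suc q ^ k                  ≡⟨ cong (_* suc q ^ k) eq ⟨
  suc q * suc q ^ k                  ≤⟨ bernoulli q k ⟩
  suc q * q ^ k + k * suc q ^ k      ≡⟨ cong (λ m → m * q ^ k + k * suc q ^ k) eq ⟩
  2 * k * q ^ k + k * suc q ^ k      ≡⟨ cong (_+ k * suc q ^ k) (reorder k (q ^ k)) ⟩
  k * (2 * q ^ k) + k * suc q ^ k    ∎))
  where
  open ≤-Reasoning
  twice : ∀ k x → k * x + k * x ≡ 2 * k * x
  twice = solve-∀
  reorder : ∀ k x → 2 * k * x ≡ k * (2 * x)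
  reorder = solve-∀

-- (q/m)^x only decreases in x, so it suffices to take x = kj, which is j successive halvings.
halvings : ∀ q k j x → suc q ≡ 2 * k → .{{_ : NonZero k}} → x ≤ k * j →
           suc q ^ x ≤ 2 ^ j * q ^ x
halvings q k j x eq x≤kj = *-cancelʳ-≤ _ _ (m ^ y) {{m^n≢0 m y}} (begin
  m ^ x * m ^ y              ≡⟨ split m ⟩
  m ^ (k * j)                ≡⟨ ^-*-assoc m k j ⟨
  (m ^ k) ^ j                ≤⟨ ^-monoˡ-≤ j (halving q k eq) ⟩
  (2 * q ^ k) ^ j            ≡⟨ ^-distribʳ-* 2 (q ^ k) j ⟩
  2 ^ j * (q ^ k) ^ j        ≡⟨ cong (2 ^ j *_) (^-*-assoc q k j) ⟩
  2 ^ j * q ^ (k * j)        ≡⟨ cong (2 ^ j *_) (split q) ⟨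
  2 ^ j * (q ^ x * q ^ y)    ≤⟨ *-monoʳ-≤ (2 ^ j) (*-monoʳ-≤ (q ^ x) (^-monoˡ-≤ y (n≤1+n q))) ⟩
  2 ^ j * (q ^ x * m ^ y)    ≡⟨ *-assoc (2 ^ j) (q ^ x) (m ^ y) ⟨
  2 ^ j * q ^ x * m ^ y      ∎)
  where
  open ≤-Reasoning
  m = suc q
  y = k * j ∸ x
  split : ∀ a → a ^ x * a ^ y ≡ a ^ (k * j)
  split a = trans (sym (^-distribˡ-+-* a x y)) (cong (a ^_) (m+[n∸m]≡n x≤kj))

-- With x factors equal to `a` the product is a^x b^(n - x); the extra factor b^x on the left avoids
-- the subtraction.
product-choice : ∀ {A : Set} {n} (a b : ℕ) (χ : A → Bool) (g : Fin n → A) →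
  List.product (map (λ w → if χ w then a else b) (tabulate g)) * b ^ (∑[ i < n ] ⟦ χ (g i) ⟧)
    ≡ a ^ (∑[ i < n ] ⟦ χ (g i) ⟧) * b ^ n
product-choice {n = zero}  a b χ g = refl
product-choice {n = suc n} a b χ g with χ (g zero) | product-choice a b χ (g ∘ suc)
... | true  | ih = trans (lhs a b _ _) (trans (cong (λ z → a * b * z) ih) (rhs a b _ _))
  where
  lhs : ∀ a b p z → a * p * (b * z) ≡ a * b * (p * z)
  lhs = solve-∀
  rhs : ∀ a b p z → a * b * (p * z) ≡ a * p * (b * z)
  rhs = solve-∀
... | false | ih = trans (*-assoc b _ _) (trans (cong (b *_) ih)
  (rhs b (a ^ (∑[ i < n ] ⟦ χ (g (suc i)) ⟧)) (b ^ n)))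
  where
  rhs : ∀ b p z → b * (p * z) ≡ p * (b * z)
  rhs = solve-∀

product-bounded : ∀ {A : Set} {n} b (f : A → ℕ) (g : Fin n → A) → (∀ w → f w ≤ b) →
  List.product (map f (tabulate g)) ≤ b ^ n
product-bounded {n = zero}  b f g h = ≤-refl
product-bounded {n = suc n} b f g h = *-mono-≤ (h (g zero)) (product-bounded b f (g ∘ suc) h)

product-zero : ∀ {A : Set} {n} (f : A → ℕ) (g : Fin n → A) i → f (g i) ≡ 0 →
  List.product (map f (tabulate g)) ≡ 0
product-zero f g zero    eq rewrite eq = refl
product-zero f g (suc i) eq rewrite product-zero f (g ∘ suc) i eq = *-zeroʳ (f (g zero))

-- The hard-core model on a graph with few edges inside neighbourhoods.

module HardCore {N : ℕ} (c : Fin N → Fin N → Bool)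
  (c-sym : ∀ i j → c i j ≡ c j i) (c-irrefl : ∀ i → c i i ≡ false) where

  Independent : Vec Bool N → Set
  Independent I = ∀ i j → lookup I i ≡ true → lookup I j ≡ true → c i j ≡ false

  Free : Fin N → Vec Bool N → Set
  Free u I = ∀ w → lookup I w ≡ true → c u w ≡ false

  ball : Fin N → Fin N → Bool
  ball v w = does (w ≟ v) ∨ c v w

  -- The choice w = v is counted as well, so this is the degree of `v` plus twice the number of
  -- edges inside its neighbourhood.
  triangles : Fin N → ℕ
  triangles v = ∑[ u < N ] (⟦ c v u ⟧ * ∑[ w < N ] ⟦ c u w ∧ ball v w ⟧)

  -- Depends only on the configuration outside the closed neighbourhood of v (availᵇ-ignores).
  Available : Fin N → Fin N → Vec Bool N → Set
  Available v u I = ∀ w → lookup I w ≡ true → c u w ≡ true → ball v w ≡ true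

  abstract
    independent? : ∀ I → Dec (Independent I)
    independent? I = all? λ i → all? λ j →
      (lookup I i ≟ᵇ true) →-dec ((lookup I j ≟ᵇ true) →-dec (c i j ≟ᵇ false))

    free? : ∀ u I → Dec (Free u I)
    free? u I = all? λ w → (lookup I w ≟ᵇ true) →-dec (c u w ≟ᵇ false)

    available? : ∀ v u I → Dec (Available v u I)
    available? v u I = all? λ w →
      (lookup I w ≟ᵇ true) →-dec ((c u w ≟ᵇ true) →-dec (ball v w ≟ᵇ true))

  ind : Vec Bool N → ℕ
  ind I = ⟦ does (independent? I) ⟧

  free : Fin N → Vec Bool N → ℕ
  free u I = ⟦ does (free? u I) ⟧

  availᵇ : Fin N → Fin N → Vec Bool N → Bool
  availᵇ v u I = does (available? v u I)

  avail : Fin N → Fin N → Vec Bool N → ℕ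
  avail v u I = ⟦ availᵇ v u I ⟧

  mem : Fin N → Vec Bool N → ℕ
  mem u I = ⟦ lookup I u ⟧

  mem-off : ∀ (u : Fin N) (I : Vec Bool N) → mem u (I [ u ]≔ false) ≡ 0
  mem-off u I = cong ⟦_⟧ (lookup∘update u I false)

  mem-on : ∀ (u : Fin N) (I : Vec Bool N) → mem u (I [ u ]≔ true) ≡ 1
  mem-on u I = cong ⟦_⟧ (lookup∘update u I true)

  on-of-off : ∀ (u : Fin N) (I : Vec Bool N) b w →
    lookup (I [ u ]≔ false) w ≡ true → lookup (I [ u ]≔ b) w ≡ true
  on-of-off u I b w p with w ≟ u
  ... | yes refl = contradiction (trans (sym (lookup∘update u I false)) p) λ ()
  ... | no w≢u = trans (lookup∘update′ w≢u I b) (trans (sym (lookup∘update′ w≢u I false)) p)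

  off-of-on : ∀ (u : Fin N) (I : Vec Bool N) b w → w ≢ u →
    lookup (I [ u ]≔ b) w ≡ true → lookup (I [ u ]≔ false) w ≡ true
  off-of-on u I b w w≢u p =
    trans (lookup∘update′ w≢u I false) (trans (sym (lookup∘update′ w≢u I b)) p)

  ind-shrink : ∀ u I → ind (I [ u ]≔ true) ≤ ind (I [ u ]≔ false)
  ind-shrink u I = ⟦dec⟧-mono (independent? (I [ u ]≔ true)) (independent? (I [ u ]≔ false))
    λ h i j p r → h i j (on-of-off u I true i p) (on-of-off u I true j r)

  ind-grow : ∀ u I → ind (I [ u ]≔ false) * free u (I [ u ]≔ false) ≤ ind (I [ u ]≔ true)
  ind-grow u I with independent? (I [ u ]≔ false) | free? u (I [ u ]≔ false)
  ... | no _  | _    = z≤n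
  ... | yes _ | no _ = z≤n
  ... | yes h | yes f = ≤-reflexive (cong ⟦_⟧ (sym (dec-true (independent? (I [ u ]≔ true)) ext)))
    where
    ext : Independent (I [ u ]≔ true)
    ext i j p r with i ≟ u | j ≟ u
    ... | yes refl | yes refl = c-irrefl i
    ... | yes refl | no j≢u = f j (off-of-on u I true j j≢u r)
    ... | no i≢u | yes refl = trans (c-sym i j) (f i (off-of-on u I true i i≢u p))
    ... | no i≢u | no j≢u = h i j (off-of-on u I true i i≢u p) (off-of-on u I true j j≢u r)

  Ignores : ∀ {A : Set} → Fin N → (Vec Bool N → A) → Set
  Ignores u F = ∀ I → F (I [ u ]≔ true) ≡ F (I [ u ]≔ false)

  availᵇ-ignores : ∀ v w u → ball v u ≡ true → Ignores u (availᵇ v w)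
  availᵇ-ignores v w u bu I =
    does-⇔ (mk⇔ (λ h z p → h z (on-of-off u I true z p)) back)
      (available? v w (I [ u ]≔ true)) (available? v w (I [ u ]≔ false))
    where
    back : Available v w (I [ u ]≔ false) → Available v w (I [ u ]≔ true)
    back h z p with z ≟ u
    ... | yes refl = λ _ → bu
    ... | no z≢u = h z (off-of-on u I true z z≢u p)

  ¬free⇒ : ∀ u I → ¬ Free u I → ∃ λ w → lookup I w ≡ true × c u w ≡ true
  ¬free⇒ u I ¬f with ¬∀⟶∃¬ N _ (λ w → (lookup I w ≟ᵇ true) →-dec (c u w ≟ᵇ false)) ¬f
  ... | w , ¬p with lookup I w in e | c u w in e′
  ...   | true  | true  = w , e , e′
  ...   | true  | false = contradiction (λ _ → refl) ¬p
  ...   | false | _     = contradiction (λ ()) ¬p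

  ¬available⇒ : ∀ v u I → ¬ Available v u I → ∃ λ w → lookup I w ≡ true × c u w ≡ true
  ¬available⇒ v u I ¬a = ¬free⇒ u I λ f → ¬a λ w p r → contradiction (trans (sym r) (f w p)) λ ()

  unavailable⇒ : ∀ v u I → availᵇ v u I ≡ false → lookup I u ≡ true → ind I ≡ 0
  unavailable⇒ v u I av on with independent? I
  ... | no _ = refl
  ... | yes h with ¬available⇒ v u I (λ a → contradiction (trans (sym av) (dec-true (available? v u I) a)) λ ())
  ...   | w , p , r = contradiction (trans (sym r) (h u w on p)) λ ()

  module Weights (q : ℕ) where
    open Weighted q

    m = suc q

    μ : (Vec Bool N → ℕ) → ℕ
    μ F = E λ I → ind I * F I

    Z : ℕ
    Z = μ λ _ → 1

    occ : Fin N → ℕ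
    occ u = μ (mem u)

    μ-mono : ∀ {F G} → (∀ I → F I ≤ G I) → μ F ≤ μ G
    μ-mono h = E-mono λ I → *-monoʳ-≤ (ind I) (h I)

    μ-+ : ∀ F G → μ (λ I → F I + G I) ≡ μ F + μ G
    μ-+ F G = trans (E-cong λ I → *-distribˡ-+ (ind I) (F I) (G I))
      (E-+ (λ I → ind I * F I) (λ I → ind I * G I))

    μ-* : ∀ k F → μ (λ I → k * F I) ≡ k * μ F
    μ-* k F = trans (E-cong λ I → swap (ind I) k (F I)) (E-* k (λ I → ind I * F I))
      where
      swap : ∀ a k b → a * (k * b) ≡ k * (a * b)
      swap = solve-∀

    μ-∑ : ∀ {n} (F : Fin n → Vec Bool N → ℕ) → μ (λ I → ∑[ i < n ] F i I) ≡ ∑[ i < n ] μ (F i)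
    μ-∑ F = trans (E-cong λ I → *-distribˡ-sum (ind I) (λ i → F i I)) (E-∑ λ i I → ind I * F i I)

    μ-∑* : ∀ {n} (a : Fin n → ℕ) (F : Fin n → Vec Bool N → ℕ) →
      μ (λ I → ∑[ i < n ] (a i * F i I)) ≡ ∑[ i < n ] (a i * μ (F i))
    μ-∑* a F = trans (μ-∑ (λ i I → a i * F i I)) (sum-cong-≗ λ i → μ-* (a i) (F i))

    μ-const : ∀ k → μ (λ _ → k) ≡ k * Z
    μ-const k = trans (E-cong λ I → cong (ind I *_) (sym (*-identityʳ k))) (μ-* k _)

    -- An unoccupied u with no occupied neighbour may be switched on.
    free≤occ : ∀ u → μ (free u) ≤ m * occ u
    free≤occ u = ≤-trans (E-resample u _ _ step) (≤-reflexive (μ-* m (mem u)))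
      where
      open ≤-Reasoning
      step : ∀ I → q * (ind (I [ u ]≔ false) * free u (I [ u ]≔ false))
                     + ind (I [ u ]≔ true) * free u (I [ u ]≔ true)
                 ≤ q * (ind (I [ u ]≔ false) * (m * mem u (I [ u ]≔ false)))
                     + ind (I [ u ]≔ true) * (m * mem u (I [ u ]≔ true))
      step I rewrite mem-off u I | mem-on u I = begin
        q * (i₀ * free u I₀) + i₁ * free u I₁
          ≤⟨ +-mono-≤ (*-monoʳ-≤ q (ind-grow u I)) (*-monoʳ-≤ i₁ (⟦⟧≤1 (does (free? u I₁)))) ⟩
        q * i₁ + i₁ * 1                             ≡⟨ regroup q i₀ i₁ ⟩
        q * (i₀ * (m * 0)) + i₁ * (m * 1)           ∎
        where
        I₀ = I [ u ]≔ false
        I₁ = I [ u ]≔ true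
        i₀ = ind I₀
        i₁ = ind I₁
        regroup : ∀ q a b → q * b + b * 1 ≡ q * (a * (suc q * 0)) + b * (suc q * 1)
        regroup = solve-∀

    -- Switching `u` off keeps the set independent, keeps the value of `g` and multiplies the weight
    -- by `q`. Hence configurations with `u` occupied carry at most a 1/m share of the `g`-mass.
    occ-rare : ∀ u g → Ignores u g → m * μ (λ I → g I * mem u I) ≤ μ g
    occ-rare u g ig = ≤-trans (≤-reflexive (sym (μ-* m _))) (E-resample u _ _ step)
      where
      open ≤-Reasoning
      step : ∀ I → q * (ind (I [ u ]≔ false) * (m * (g (I [ u ]≔ false) * mem u (I [ u ]≔ false))))
                     + ind (I [ u ]≔ true) * (m * (g (I [ u ]≔ true) * mem u (I [ u ]≔ true)))
                 ≤ q * (ind (I [ u ]≔ false) * g (I [ u ]≔ false))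
                     + ind (I [ u ]≔ true) * g (I [ u ]≔ true)
      step I rewrite mem-off u I | mem-on u I | ig I = begin
        q * (i₀ * (m * (g₀ * 0))) + i₁ * (m * (g₀ * 1))   ≡⟨ regroup q i₀ i₁ g₀ ⟩
        q * (i₁ * g₀) + i₁ * g₀
          ≤⟨ +-monoˡ-≤ _ (*-monoʳ-≤ q (*-monoˡ-≤ g₀ (ind-shrink u I))) ⟩
        q * (i₀ * g₀) + i₁ * g₀                           ∎
        where
        i₀ = ind (I [ u ]≔ false)
        i₁ = ind (I [ u ]≔ true)
        g₀ = g (I [ u ]≔ false)
        regroup : ∀ q a b g → q * (a * (suc q * (g * 0))) + b * (suc q * (g * 1)) ≡ q * (b * g) + b * g
        regroup = solve-∀

    module _ (v : Fin N) where
      open ≤-Reasoning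

      -- Probabilities scaled by m. `γ` is the indicator that `w` is not an occupied neighbour of
      -- `v`; `β` is the lower estimate q/m or 1 for the conditional probability of that event. Over
      -- all `w`, the products are m^N times the indicator that `v` has no occupied neighbour, and
      -- m^N (q/m)^x with x the number of available neighbours.
      β γ : Vec Bool N → Fin N → ℕ
      β I w = if c v w ∧ availᵇ v w I then q else m
      γ I w = if c v w ∧ lookup I w then 0 else m

      nAvail : Vec Bool N → ℕ
      nAvail I = ∑[ w < N ] ⟦ c v w ∧ availᵇ v w I ⟧

      -- Integrating out the coordinate u: an available u is unoccupied with conditional probability
      -- at least q / m, and an unavailable u is never occupied.
      expose : ∀ u H → (c v u ≡ true → Ignores u H) → μ (λ I → H I * β I u) ≤ μ (λ I → H I * γ I u)
      expose u H ig with c v u ≟ᵇ true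
      ... | no ¬c = μ-mono λ I → *-monoʳ-≤ (H I) (≤-reflexive (same I))
        where
        same : ∀ I → β I u ≡ γ I u
        same I rewrite ¬-not ¬c = refl
      ... | yes cvu = E-resample u _ _ step
        where
        step : ∀ I → q * (ind (I [ u ]≔ false) * (H (I [ u ]≔ false) * β (I [ u ]≔ false) u))
                       + ind (I [ u ]≔ true) * (H (I [ u ]≔ true) * β (I [ u ]≔ true) u)
                   ≤ q * (ind (I [ u ]≔ false) * (H (I [ u ]≔ false) * γ (I [ u ]≔ false) u))
                       + ind (I [ u ]≔ true) * (H (I [ u ]≔ true) * γ (I [ u ]≔ true) u)
        step I rewrite lookup∘update u I false | lookup∘update u I true | ig cvu I
          | sym (availᵇ-ignores v u u (trans (cong (_ ∨_) cvu) (∨-zeroʳ _)) I) | cvu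
          with availᵇ v u (I [ u ]≔ true) in av
        ... | true = begin
          q * (i₀ * (h * q)) + i₁ * (h * q)   ≤⟨ +-monoʳ-≤ _ (*-monoˡ-≤ (h * q) (ind-shrink u I)) ⟩
          q * (i₀ * (h * q)) + i₀ * (h * q)   ≡⟨ regroup q i₀ i₁ h ⟩
          q * (i₀ * (h * m)) + i₁ * (h * 0)   ∎
          where
          i₀ = ind (I [ u ]≔ false)
          i₁ = ind (I [ u ]≔ true)
          h = H (I [ u ]≔ false)
          regroup : ∀ q a b h → q * (a * (h * q)) + a * (h * q) ≡ q * (a * (h * suc q)) + b * (h * 0)
          regroup = solve-∀
        ... | false rewrite unavailable⇒ v u (I [ u ]≔ true) av (lookup∘update u I true) = ≤-refl

      -- The factors are exchanged one vertex at a time. When `u` is integrated out, the remaining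
      -- `β` do not see it because availability ignores the closed neighbourhood of `v`, and the
      -- accumulated `γ` do not see it because they belong to other vertices; the latter is where
      -- distinctness of the list enters.
      expose-all : ∀ ws → Unique ws → ∀ G → All (λ u → c v u ≡ true → Ignores u G) ws →
        μ (λ I → G I * List.product (map (β I) ws)) ≤ μ (λ I → G I * List.product (map (γ I) ws))
      expose-all []       _         G _          = ≤-refl
      expose-all (u ∷ ws) (u∉ ∷ un) G (igu ∷ ig) = begin
        μ (λ I → G I * (β I u * List.product (map (β I) ws)))
          ≡⟨ E-cong (λ I → cong (ind I *_) (swap (G I) (β I u) _)) ⟩
        μ (λ I → G I * List.product (map (β I) ws) * β I u)
          ≤⟨ expose u (λ I → G I * List.product (map (β I) ws)) rest-ignores ⟩
        μ (λ I → G I * List.product (map (β I) ws) * γ I u)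
          ≡⟨ E-cong (λ I → cong (ind I *_) (swap′ (G I) (γ I u) _)) ⟩
        μ (λ I → G I * γ I u * List.product (map (β I) ws))
          ≤⟨ expose-all ws un (λ I → G I * γ I u) (ignore ws u∉ ig) ⟩
        μ (λ I → G I * γ I u * List.product (map (γ I) ws))
          ≡⟨ E-cong (λ I → cong (ind I *_) (*-assoc (G I) (γ I u) _)) ⟩
        μ (λ I → G I * (γ I u * List.product (map (γ I) ws)))   ∎
        where
        swap : ∀ a b p → a * (b * p) ≡ a * p * b
        swap = solve-∀
        swap′ : ∀ a b p → a * p * b ≡ a * b * p
        swap′ = solve-∀
        nbr⇒ball : c v u ≡ true → ball v u ≡ true
        nbr⇒ball cvu = trans (cong (_ ∨_) cvu) (∨-zeroʳ _)
        rest-ignores : c v u ≡ true → Ignores u (λ I → G I * List.product (map (β I) ws))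
        rest-ignores cvu I = cong₂ _*_ (igu cvu I) (cong List.product (map-cong
          (λ w → cong (λ a → if c v w ∧ a then q else m) (availᵇ-ignores v w u (nbr⇒ball cvu) I)) ws))
        ignore : ∀ xs → All (u ≢_) xs → All (λ u′ → c v u′ ≡ true → Ignores u′ G) xs →
                 All (λ u′ → c v u′ ≡ true → Ignores u′ (λ I → G I * γ I u)) xs
        ignore []       []       []        = []
        ignore (x ∷ xs) (p ∷ ps) (r ∷ rs) =
          (λ cvx I → cong₂ _*_ (r cvx I) (cong (λ a → if c v u ∧ a then 0 else m)
            (trans (lookup∘update′ p I true) (sym (lookup∘update′ p I false))))) ∷ ignore xs ps rs

      ∏γ≤free : ∀ I → List.product (map (γ I) (allFin N)) ≤ m ^ N * free v I
      ∏γ≤free I with free? v I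
      ... | yes _ = ≤-trans (product-bounded m (γ I) id bounded) (≤-reflexive (sym (*-identityʳ _)))
        where
        bounded : ∀ w → γ I w ≤ m
        bounded w with c v w ∧ lookup I w
        ... | true  = z≤n
        ... | false = ≤-refl
      ... | no ¬f with ¬free⇒ v I ¬f
      ...   | w , p , r = ≤-trans (≤-reflexive (product-zero (γ I) id w zero-factor)) z≤n
        where
        zero-factor : γ I w ≡ 0
        zero-factor rewrite r | p = refl

      -- In probabilities: the mean of (q/m)^x is at most the probability that `v` has no occupied
      -- neighbour, which is at most m times the probability that `v` is occupied.
      ∏β≤occ : μ (λ I → List.product (map (β I) (allFin N))) ≤ m ^ N * (m * occ v)
      ∏β≤occ = begin
        μ (λ I → List.product (map (β I) (allFin N)))       ≤⟨ μ-mono (λ I → m≤m+n _ 0) ⟩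
        μ (λ I → 1 * List.product (map (β I) (allFin N)))
          ≤⟨ expose-all (allFin N) (allFin⁺ N) (λ _ → 1) (tabulateAll (λ _ _ _ → refl)) ⟩
        μ (λ I → 1 * List.product (map (γ I) (allFin N)))
          ≤⟨ μ-mono (λ I → ≤-trans (≤-reflexive (*-identityˡ _)) (∏γ≤free I)) ⟩
        μ (λ I → m ^ N * free v I)                     ≡⟨ μ-* (m ^ N) (free v) ⟩
        m ^ N * μ (free v)                             ≤⟨ *-monoʳ-≤ (m ^ N) (free≤occ v) ⟩
        m ^ N * (m * occ v)                            ∎

      -- A dichotomy that holds for each configuration: either at least kj neighbours are available
      -- and the second term suffices, or (q/m)^x ≥ 2^(-j) and the first does. Adding the two terms
      -- lets the case split pass through the expectation.
      tradeoff : ∀ k j → m ≡ 2 * k → .{{_ : NonZero k}} → ∀ I →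
        k * j * m ^ N ≤ k * j * 2 ^ j * List.product (map (β I) (allFin N)) + nAvail I * m ^ N
      tradeoff k j eq I with k * j ≤? nAvail I
      ... | yes big = ≤-trans (*-monoˡ-≤ (m ^ N) big) (m≤n+m _ _)
      ... | no ¬big = ≤-trans
        (≤-trans (*-monoʳ-≤ (k * j) few) (≤-reflexive (sym (*-assoc (k * j) _ _)))) (m≤m+n _ _)
        where
        x = nAvail I
        few : m ^ N ≤ 2 ^ j * List.product (map (β I) (allFin N))
        few = *-cancelʳ-≤ _ _ (m ^ x) {{m^n≢0 m x}} (begin
          m ^ N * m ^ x                                              ≡⟨ *-comm (m ^ N) (m ^ x) ⟩
          m ^ x * m ^ N
            ≤⟨ *-monoˡ-≤ (m ^ N) (halvings q k j x eq (<⇒≤ (≰⇒> ¬big))) ⟩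
          2 ^ j * q ^ x * m ^ N                                      ≡⟨ *-assoc (2 ^ j) _ _ ⟩
          2 ^ j * (q ^ x * m ^ N)
            ≡⟨ cong (2 ^ j *_) (product-choice q m (λ w → c v w ∧ availᵇ v w I) id) ⟨
          2 ^ j * (List.product (map (β I) (allFin N)) * m ^ x)           ≡⟨ *-assoc (2 ^ j) _ _ ⟨
          2 ^ j * List.product (map (β I) (allFin N)) * m ^ x             ∎)

      nAvail-bound : ∀ k j → m ≡ 2 * k → .{{_ : NonZero k}} →
        k * j * Z ≤ k * j * 2 ^ j * (m * occ v) + μ nAvail
      nAvail-bound k j eq = *-cancelˡ-≤ (m ^ N) {{m^n≢0 m N}} (begin
        m ^ N * (k * j * Z)                                 ≡⟨ swap (m ^ N) (k * j) Z ⟩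
        k * j * m ^ N * Z                                   ≡⟨ μ-const (k * j * m ^ N) ⟨
        μ (λ _ → k * j * m ^ N)                             ≤⟨ μ-mono (tradeoff k j eq) ⟩
        μ (λ I → A * P I + nAvail I * m ^ N)                ≡⟨ μ-+ (λ I → A * P I) (λ I → nAvail I * m ^ N) ⟩
        μ (λ I → A * P I) + μ (λ I → nAvail I * m ^ N)
          ≡⟨ cong₂ _+_ (μ-* A P) (trans
               (E-cong (λ I → cong (ind I *_) (*-comm (nAvail I) (m ^ N)))) (μ-* (m ^ N) nAvail)) ⟩
        A * μ P + m ^ N * μ nAvail                          ≤⟨ +-monoˡ-≤ _ (*-monoʳ-≤ A ∏β≤occ) ⟩
        A * (m ^ N * (m * occ v)) + m ^ N * μ nAvail        ≡⟨ collect (m ^ N) A (m * occ v) (μ nAvail) ⟩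
        m ^ N * (A * (m * occ v) + μ nAvail)                ∎)
        where
        A = k * j * 2 ^ j
        P : Vec Bool N → ℕ
        P I = List.product (map (β I) (allFin N))
        swap : ∀ a b z → a * (b * z) ≡ b * a * z
        swap = solve-∀
        collect : ∀ a b x y → b * (a * x) + a * y ≡ a * (b * x + y)
        collect = solve-∀

      -- Union bound over the occupied neighbours of `u`: availability forces each of them into the
      -- closed neighbourhood of `v`.
      avail-cover : ∀ u I →
        avail v u I ≤ free u I + ∑[ w < N ] (⟦ c u w ∧ ball v w ⟧ * (avail v u I * mem w I))
      avail-cover u I with available? v u I
      ... | no _ = z≤n
      ... | yes a with free? u I
      ...   | yes _ = s≤s z≤n
      ...   | no ¬f with ¬free⇒ u I ¬f
      ...     | w , p , r = ≤-trans (≤-reflexive (sym one))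
                  (term≤∑ (λ w → ⟦ c u w ∧ ball v w ⟧ * (1 * mem w I)) w)
        where
        one : ⟦ c u w ∧ ball v w ⟧ * (1 * mem w I) ≡ 1
        one rewrite a w p r | r | p = refl

      -- Availability of `u` ignores every `w` in the closed neighbourhood of `v`, so each such `w`
      -- is occupied with conditional probability at most 1/m. The error is therefore the number of
      -- these `w` adjacent to `u`, divided by m.
      avail-bound : ∀ u → m * μ (avail v u) ≤ m * (m * occ u) + ∑[ w < N ] ⟦ c u w ∧ ball v w ⟧ * Z
      avail-bound u = begin
        m * μ (avail v u)                                        ≤⟨ *-monoʳ-≤ m (μ-mono (avail-cover u)) ⟩
        m * μ (λ I → free u I + ∑[ w < N ] (t w * (avail v u I * mem w I)))
          ≡⟨ cong (m *_) (trans (μ-+ (free u) (λ I → ∑[ w < N ] (t w * (avail v u I * mem w I))))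
               (cong (μ (free u) +_) (μ-∑* t (λ w I → avail v u I * mem w I)))) ⟩
        m * (μ (free u) + ∑[ w < N ] (t w * μ (λ I → avail v u I * mem w I)))
          ≡⟨ trans (*-distribˡ-+ m (μ (free u)) _) (cong (m * μ (free u) +_)
               (trans (*-distribˡ-sum m (λ w → t w * μ (λ I → avail v u I * mem w I)))
                      (sum-cong-≗ λ w → swap m (t w) _))) ⟩
        m * μ (free u) + ∑[ w < N ] (t w * (m * μ (λ I → avail v u I * mem w I)))
          ≤⟨ +-mono-≤ (*-monoʳ-≤ m (free≤occ u)) (∑-mono rare) ⟩
        m * (m * occ u) + ∑[ w < N ] (t w * Z)
          ≡⟨ cong (m * (m * occ u) +_) (*-distribʳ-sum Z t) ⟨
        m * (m * occ u) + sum t * Z                              ∎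
        where
        t : Fin N → ℕ
        t w = ⟦ c u w ∧ ball v w ⟧
        swap : ∀ a b x → a * (b * x) ≡ b * (a * x)
        swap = solve-∀
        rare : ∀ w → t w * (m * μ (λ I → avail v u I * mem w I)) ≤ t w * Z
        rare w with c u w | ball v w in bw
        ... | false | _     = z≤n
        ... | true  | false = z≤n
        ... | true  | true  = +-monoˡ-≤ 0 (≤-trans
          (occ-rare w (avail v u) (λ I → cong ⟦_⟧ (availᵇ-ignores v u w bw I)))
          (μ-mono λ I → ⟦⟧≤1 (availᵇ v u I)))

      nbrOcc : ℕ
      nbrOcc = ∑[ u < N ] (⟦ c v u ⟧ * occ u)

      nAvail-upper : m * μ nAvail ≤ m * m * nbrOcc + triangles v * Z
      nAvail-upper = begin
        m * μ nAvail
          ≡⟨ cong (m *_) (trans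
                (E-cong (λ I → cong (ind I *_) (sum-cong-≗ λ u → ⟦∧⟧ (c v u) (availᵇ v u I))))
                (μ-∑* (λ u → ⟦ c v u ⟧) (avail v))) ⟩
        m * ∑[ u < N ] (⟦ c v u ⟧ * μ (avail v u))
          ≡⟨ trans (*-distribˡ-sum m (λ u → ⟦ c v u ⟧ * _)) (sum-cong-≗ λ u → swap m ⟦ c v u ⟧ _) ⟩
        ∑[ u < N ] (⟦ c v u ⟧ * (m * μ (avail v u)))
          ≤⟨ ∑-mono (λ u → *-monoʳ-≤ ⟦ c v u ⟧ (avail-bound u)) ⟩
        ∑[ u < N ] (⟦ c v u ⟧ * (m * (m * occ u) + t u * Z))
          ≡⟨ sum-cong-≗ (λ u → expand ⟦ c v u ⟧ m (occ u) (t u) Z) ⟩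
        ∑[ u < N ] (m * m * (⟦ c v u ⟧ * occ u) + ⟦ c v u ⟧ * t u * Z)
          ≡⟨ ∑-distrib-+ (λ u → m * m * (⟦ c v u ⟧ * occ u)) (λ u → ⟦ c v u ⟧ * t u * Z) ⟩
        ∑[ u < N ] (m * m * (⟦ c v u ⟧ * occ u)) + ∑[ u < N ] (⟦ c v u ⟧ * t u * Z)
          ≡⟨ cong₂ _+_ (*-distribˡ-sum (m * m) (λ u → ⟦ c v u ⟧ * occ u))
               (*-distribʳ-sum Z (λ u → ⟦ c v u ⟧ * t u)) ⟨
        m * m * nbrOcc + triangles v * Z                 ∎
        where
        t : Fin N → ℕ
        t u = ∑[ w < N ] ⟦ c u w ∧ ball v w ⟧
        swap : ∀ a b x → a * (b * x) ≡ b * (a * x)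
        swap = solve-∀
        expand : ∀ a m o t z → a * (m * (m * o) + t * z) ≡ m * m * (a * o) + a * t * z
        expand = solve-∀

      -- Lower and upper estimates for the expected number of available neighbours are compared
      -- after multiplication by m = 2k. The left side becomes 2k²j Z; the local edge count uses up
      -- at most half of it, and the other half is divided by k². The bound on `D` absorbs the
      -- coefficient k j 2^j of `occ v`.
      local-occupancy : ∀ k j D → m ≡ 2 * k → .{{_ : NonZero k}} → k * (j * 2 ^ j) ≤ D →
        triangles v ≤ k * (k * j) → j * Z ≤ 4 * (D * occ v + nbrOcc)
      local-occupancy k j D eq kj≤D tri = *-cancelˡ-≤ (k * k) {{m*n≢0 k k}}
        (+-cancelʳ-≤ (k * (k * j) * Z) _ _ (begin
        k * k * (j * Z) + k * (k * j) * Z                          ≡⟨ double k j Z ⟩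
        2 * k * (k * j * Z)                                        ≡⟨ cong (_* (k * j * Z)) eq ⟨
        m * (k * j * Z)                                            ≤⟨ *-monoʳ-≤ m (nAvail-bound k j eq) ⟩
        m * (k * j * 2 ^ j * (m * occ v) + μ nAvail)
          ≡⟨ *-distribˡ-+ m (k * j * 2 ^ j * (m * occ v)) (μ nAvail) ⟩
        m * (k * j * 2 ^ j * (m * occ v)) + m * μ nAvail
          ≤⟨ +-monoʳ-≤ (m * (k * j * 2 ^ j * (m * occ v))) nAvail-upper ⟩
        m * (k * j * 2 ^ j * (m * occ v)) + (m * m * nbrOcc + triangles v * Z)
          ≡⟨ cong (λ m → m * (k * j * 2 ^ j * (m * occ v)) + (m * m * nbrOcc + triangles v * Z)) eq ⟩
        2 * k * (k * j * 2 ^ j * (2 * k * occ v)) + (2 * k * (2 * k) * nbrOcc + triangles v * Z)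
          ≡⟨ collect k j (2 ^ j) (occ v) nbrOcc (triangles v * Z) ⟩
        k * k * (4 * (k * (j * 2 ^ j) * occ v + nbrOcc)) + triangles v * Z
          ≤⟨ +-mono-≤ (*-monoʳ-≤ (k * k) (*-monoʳ-≤ 4 (+-monoˡ-≤ nbrOcc (*-monoˡ-≤ (occ v) kj≤D))))
                      (*-monoˡ-≤ Z tri) ⟩
        k * k * (4 * (D * occ v + nbrOcc)) + k * (k * j) * Z       ∎))
        where
        double : ∀ k j z → k * k * (j * z) + k * (k * j) * z ≡ 2 * k * (k * j * z)
        double = solve-∀
        collect : ∀ k j p o n t → 2 * k * (k * j * p * (2 * k * o)) + (2 * k * (2 * k) * n + t)
                                ≡ k * k * (4 * (k * (j * p) * o + n)) + t
        collect = solve-∀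

    totalOcc : ℕ
    totalOcc = ∑[ u < N ] occ u

    module _ (D : ℕ) (degree≤ : ∀ v → ∑[ u < N ] ⟦ c v u ⟧ ≤ D) where
      open ≤-Reasoning

      ∑nbrOcc≤ : ∑[ v < N ] nbrOcc v ≤ D * totalOcc
      ∑nbrOcc≤ = begin
        ∑[ v < N ] ∑[ u < N ] (⟦ c v u ⟧ * occ u)    ≡⟨ ∑-comm (λ v u → ⟦ c v u ⟧ * occ u) ⟩
        ∑[ u < N ] ∑[ v < N ] (⟦ c v u ⟧ * occ u)
          ≡⟨ sum-cong-≗ (λ u → trans (sum-cong-≗ λ v → cong (λ b → ⟦ b ⟧ * occ u) (c-sym v u))
                                    (sym (*-distribʳ-sum (occ u) (λ v → ⟦ c u v ⟧)))) ⟩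
        ∑[ u < N ] (∑[ v < N ] ⟦ c u v ⟧ * occ u)    ≤⟨ ∑-mono (λ u → *-monoˡ-≤ (occ u) (degree≤ u)) ⟩
        ∑[ u < N ] (D * occ u)                       ≡⟨ *-distribˡ-sum D occ ⟨
        D * totalOcc                                 ∎

      occupancy : ∀ k j → m ≡ 2 * k → .{{_ : NonZero k}} → k * (j * 2 ^ j) ≤ D →
        (∀ v → triangles v ≤ k * (k * j)) → N * j * Z ≤ 8 * D * totalOcc
      occupancy k j eq kj≤D tri = begin
        N * j * Z                                            ≡⟨ trans (*-assoc N j Z) (sym (∑-const N (j * Z))) ⟩
        ∑[ v < N ] (j * Z)                                   ≤⟨ ∑-mono (λ v → local-occupancy v k j D eq kj≤D (tri v)) ⟩
        ∑[ v < N ] (4 * (D * occ v + nbrOcc v))              ≡⟨ *-distribˡ-sum 4 (λ v → D * occ v + nbrOcc v) ⟨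
        4 * ∑[ v < N ] (D * occ v + nbrOcc v)
          ≡⟨ cong (4 *_) (trans (∑-distrib-+ (λ v → D * occ v) nbrOcc)
                                (cong (_+ sum nbrOcc) (sym (*-distribˡ-sum D occ)))) ⟩
        4 * (D * totalOcc + ∑[ v < N ] nbrOcc v)             ≤⟨ *-monoʳ-≤ 4 (+-monoʳ-≤ (D * totalOcc) ∑nbrOcc≤) ⟩
        4 * (D * totalOcc + D * totalOcc)                    ≡⟨ double D totalOcc ⟩
        8 * D * totalOcc                                     ∎
        where
        double : ∀ d o → 4 * (d * o + d * o) ≡ 8 * d * o
        double = solve-∀

      -- The estimate for bounded degree, with no logarithmic gain: in each configuration `v` either
      -- has no occupied neighbour, and may be switched on, or is counted by an occupied neighbour.
      trivial-occupancy : N * Z ≤ (m + D) * totalOcc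
      trivial-occupancy = begin
        N * Z                                     ≡⟨ ∑-const N Z ⟨
        ∑[ v < N ] Z                              ≤⟨ ∑-mono local ⟩
        ∑[ v < N ] (m * occ v + nbrOcc v)
          ≡⟨ trans (∑-distrib-+ (λ v → m * occ v) nbrOcc)
                   (cong (_+ sum nbrOcc) (sym (*-distribˡ-sum m occ))) ⟩
        m * totalOcc + ∑[ v < N ] nbrOcc v        ≤⟨ +-monoʳ-≤ (m * totalOcc) ∑nbrOcc≤ ⟩
        m * totalOcc + D * totalOcc               ≡⟨ *-distribʳ-+ totalOcc m D ⟨
        (m + D) * totalOcc                        ∎
        where
        cover : ∀ v I → 1 ≤ free v I + ∑[ u < N ] (⟦ c v u ⟧ * mem u I)
        cover v I with free? v I
        ... | yes _ = s≤s z≤n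
        ... | no ¬f with ¬free⇒ v I ¬f
        ...   | w , p , r = ≤-trans (≤-reflexive (sym one)) (term≤∑ (λ u → ⟦ c v u ⟧ * mem u I) w)
          where
          one : ⟦ c v w ⟧ * mem w I ≡ 1
          one rewrite r | p = refl
        local : ∀ v → Z ≤ m * occ v + nbrOcc v
        local v = begin
          Z                                                           ≤⟨ μ-mono (cover v) ⟩
          μ (λ I → free v I + ∑[ u < N ] (⟦ c v u ⟧ * mem u I))
            ≡⟨ trans (μ-+ (free v) _) (cong (μ (free v) +_) (μ-∑* (λ u → ⟦ c v u ⟧) mem)) ⟩
          μ (free v) + nbrOcc v                                       ≤⟨ +-monoˡ-≤ _ (free≤occ v) ⟩
          m * occ v + nbrOcc v                                        ∎

    Z-positive : .{{_ : NonZero q}} → 0 < Z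
    Z-positive = E-positive (λ I → ind I * 1)
      (≤-reflexive (sym (cong (λ b → ⟦ b ⟧ * 1) (dec-true (independent? (replicate N false)) empty))))
      where
      empty : Independent (replicate N false)
      empty i j p = contradiction (trans (sym (lookup-replicate i false)) p) λ ()

    large-independent : .{{_ : NonZero q}} → ∀ A C → A * Z ≤ C * totalOcc →
      ∃ λ I → Independent I × A ≤ C * ∑[ u < N ] ⟦ lookup I u ⟧
    -- The added 1 makes the inequality of means strict, so that some configuration satisfies it;
    -- there it reads A < C · size + 1. The factor `ind I` on both sides forces that configuration
    -- to be independent.
    large-independent A C h with E-<⇒∃ (λ I → ind I * A) (λ I → ind I * (C * size I + 1)) lt
      where
      open ≤-Reasoning
      size : Vec Bool N → ℕ
      size I = ∑[ u < N ] ⟦ lookup I u ⟧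
      lt : μ (λ _ → A) < μ (λ I → C * size I + 1)
      lt = begin-strict
        μ (λ _ → A)                          ≡⟨ μ-const A ⟩
        A * Z                                ≤⟨ h ⟩
        C * totalOcc                         ≡⟨ trans (μ-* C size) (cong (C *_) (μ-∑ (λ u I → mem u I))) ⟨
        μ (λ I → C * size I)                 <⟨ m<m+n _ Z-positive ⟩
        μ (λ I → C * size I) + Z             ≡⟨ μ-+ (λ I → C * size I) (λ _ → 1) ⟨
        μ (λ I → C * size I + 1)             ∎
    ... | I , p with independent? I
    ...   | yes ii = I , ii ,
      s≤s⁻¹ (≤-trans (subst₂ _<_ (+-identityʳ A) (+-identityʳ _) p) (≤-reflexive (+-comm _ 1)))
    ...   | no _ = contradiction p λ ()

∧-true : ∀ {a b} → a ∧ b ≡ true → a ≡ true × b ≡ true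
∧-true {true} {true} _ = refl , refl

card : ∀ {n} → (Fin n → Bool) → ℕ
card {n} χ = ∑[ i < n ] ⟦ χ i ⟧

card-∧ : ∀ {n} (A B : Fin n → Bool) → card (λ i → A i ∧ B i) ≤ card A
card-∧ A B = ∑-mono λ i → ⟦⟧-mono {A i ∧ B i} (proj₁ ∘ ∧-true)

-- A weak Kővári–Sós–Turán bound: if every vertex of B has more than |A| / r neighbours in A, some vertex
-- of A sees a 1 / r fraction of B; restricting B to it and iterating builds the biclique.
module Incidence {M N : ℕ} (R : Fin M → Fin N → Bool) where

  Biclique : ℕ → ℕ → Set
  Biclique s t = Σ (Fin s → Fin M) λ φ → Injective _≡_ _≡_ φ ×
                 Σ (Fin t → Fin N) λ ψ → Injective _≡_ _≡_ ψ ×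
                 (∀ i j → R (φ i) (ψ j) ≡ true)

  degIn : (Fin M → Bool) → Fin N → ℕ
  degIn A y = card λ x → A x ∧ R x y

  Star : ℕ → ℕ → (Fin M → Bool) → (Fin N → Bool) → Set
  Star i t A B = Σ (Fin i → Fin M) λ φ → Injective _≡_ _≡_ φ × (∀ k → A (φ k) ≡ true) ×
               Σ (Fin N → Bool) λ C → t ≤ card C ×
               (∀ y → C y ≡ true → B y ≡ true × (∀ k → R (φ k) y ≡ true))

  -- Each `y` in `B` has more than s/r neighbours in `A`, and `A` has at most s elements, so by
  -- double counting some `x` in `A` reaches the average |B|/r. The slack suc i * r provides
  -- strictness here and is spent when chosen vertices are deleted.
  popular-vertex : ∀ i (A : Fin M → Bool) (B : Fin N → Bool) s r → 0 < r → 0 < card B →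
    card A ≤ s → (∀ y → B y ≡ true → s + suc i * r ≤ r * degIn A y) →
    ∃ λ x → A x ≡ true × card B ≤ r * card (λ y → B y ∧ R x y)
  popular-vertex i A B s r r>0 B>0 A≤s dense
    with ∑-<⇒∃ (λ x → ⟦ A x ⟧ * card B) (λ x → ⟦ A x ⟧ * (r * card (λ y → B y ∧ R x y))) lt
    where
    open ≤-Reasoning
    dense′ : ∀ y → ⟦ B y ⟧ * (s + suc i * r) ≤ ⟦ B y ⟧ * (r * degIn A y)
    dense′ y with B y in eq
    ... | true  = +-monoˡ-≤ 0 (dense y eq)
    ... | false = z≤n
    flip-term : ∀ x y → ⟦ B y ⟧ * ⟦ A x ∧ R x y ⟧ ≡ ⟦ A x ⟧ * ⟦ B y ∧ R x y ⟧
    flip-term x y rewrite ⟦∧⟧ (A x) (R x y) | ⟦∧⟧ (B y) (R x y) = swap ⟦ B y ⟧ ⟦ A x ⟧ ⟦ R x y ⟧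
      where
      swap : ∀ b a c → b * (a * c) ≡ a * (b * c)
      swap = solve-∀
    pull : ∀ a b c → a * (b * c) ≡ b * (a * c)
    pull = solve-∀
    double-count : ∑[ y < N ] (⟦ B y ⟧ * (r * degIn A y))
                 ≡ ∑[ x < M ] (⟦ A x ⟧ * (r * card (λ y → B y ∧ R x y)))
    double-count = begin-equality
      ∑[ y < N ] (⟦ B y ⟧ * (r * degIn A y))
        ≡⟨ sum-cong-≗ (λ y → pull ⟦ B y ⟧ r (degIn A y)) ⟩
      ∑[ y < N ] (r * (⟦ B y ⟧ * degIn A y))
        ≡⟨ *-distribˡ-sum r (λ y → ⟦ B y ⟧ * degIn A y) ⟨
      r * ∑[ y < N ] (⟦ B y ⟧ * degIn A y)
        ≡⟨ cong (r *_) (sum-cong-≗ λ y → *-distribˡ-sum ⟦ B y ⟧ (λ x → ⟦ A x ∧ R x y ⟧)) ⟩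
      r * ∑[ y < N ] ∑[ x < M ] (⟦ B y ⟧ * ⟦ A x ∧ R x y ⟧)
        ≡⟨ cong (r *_) (∑-comm (λ y x → ⟦ B y ⟧ * ⟦ A x ∧ R x y ⟧)) ⟩
      r * ∑[ x < M ] ∑[ y < N ] (⟦ B y ⟧ * ⟦ A x ∧ R x y ⟧)
        ≡⟨ cong (r *_) (sum-cong-≗ λ x → trans (sum-cong-≗ λ y → flip-term x y)
             (sym (*-distribˡ-sum ⟦ A x ⟧ (λ y → ⟦ B y ∧ R x y ⟧)))) ⟩
      r * ∑[ x < M ] (⟦ A x ⟧ * card (λ y → B y ∧ R x y))
        ≡⟨ *-distribˡ-sum r (λ x → ⟦ A x ⟧ * card (λ y → B y ∧ R x y)) ⟩
      ∑[ x < M ] (r * (⟦ A x ⟧ * card (λ y → B y ∧ R x y)))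
        ≡⟨ sum-cong-≗ (λ x → pull r ⟦ A x ⟧ (card (λ y → B y ∧ R x y))) ⟩
      ∑[ x < M ] (⟦ A x ⟧ * (r * card (λ y → B y ∧ R x y)))   ∎
    lt : ∑[ x < M ] (⟦ A x ⟧ * card B) < ∑[ x < M ] (⟦ A x ⟧ * (r * card (λ y → B y ∧ R x y)))
    lt = begin-strict
      ∑[ x < M ] (⟦ A x ⟧ * card B)               ≡⟨ *-distribʳ-sum (card B) (λ x → ⟦ A x ⟧) ⟨
      card A * card B                             ≤⟨ *-monoˡ-≤ (card B) A≤s ⟩
      s * card B                                  ≡⟨ *-comm s (card B) ⟩
      card B * s
        <⟨ *-monoʳ-< (card B) {{>-nonZero B>0}} (m<m+n s (≤-trans r>0 (m≤m+n r (i * r)))) ⟩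
      card B * (s + suc i * r)                    ≡⟨ *-distribʳ-sum (s + suc i * r) (λ y → ⟦ B y ⟧) ⟩
      ∑[ y < N ] (⟦ B y ⟧ * (s + suc i * r))      ≤⟨ ∑-mono dense′ ⟩
      ∑[ y < N ] (⟦ B y ⟧ * (r * degIn A y))      ≡⟨ double-count ⟩
      ∑[ x < M ] (⟦ A x ⟧ * (r * card (λ y → B y ∧ R x y)))   ∎
  ... | x , p with A x in eq
  ...   | true = x , eq , <⇒≤ (subst₂ _<_ (+-identityʳ _) (+-identityʳ _) p)
  ...   | false = contradiction p λ ()

  -- Each chosen centre leaves at least a 1/r fraction of `B`, whence the factor r^i. Deleting it
  -- from `A` costs every `y` at most one neighbour, that is r on the scale of the hypothesis, and
  -- this is one unit of the slack i * r.
  find-star : ∀ i t (A : Fin M → Bool) (B : Fin N → Bool) s r → 0 < r → 0 < t →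
    card A ≤ s → (∀ y → B y ≡ true → s + i * r ≤ r * degIn A y) → t * r ^ i ≤ card B → Star i t A B
  find-star zero t A B s r r>0 t>0 A≤s dense B≥ =
    (λ ()) , (λ { {()} }) , (λ ()) , B , ≤-trans (≤-reflexive (sym (*-identityʳ t))) B≥ , λ y By → By , λ ()
  find-star (suc i) t A B s r r>0 t>0 A≤s dense B≥
    with popular-vertex i A B s r r>0 B>0 A≤s dense
    where
    B>0 : 0 < card B
    B>0 = ≤-trans (*-mono-≤ t>0 (m^n>0 r {{>-nonZero r>0}} (suc i))) B≥
  ... | x , Ax , B≤ with find-star i t A′ B′ s r r>0 t>0 A′≤s dense′ B′≥
    where
    open ≤-Reasoning
    A′ : Fin M → Bool
    A′ z = A z ∧ not (does (z ≟ x))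
    B′ : Fin N → Bool
    B′ y = B y ∧ R x y
    A′≤s : card A′ ≤ s
    A′≤s = ≤-trans (card-∧ A (λ z → not (does (z ≟ x)))) A≤s
    lose-one : ∀ y → degIn A y ≤ degIn A′ y + 1
    lose-one y = begin
      degIn A y                                             ≤⟨ ∑-mono term ⟩
      ∑[ z < M ] (⟦ A′ z ∧ R z y ⟧ + ⟦ does (z ≟ x) ⟧)
        ≡⟨ ∑-distrib-+ (λ z → ⟦ A′ z ∧ R z y ⟧) (λ z → ⟦ does (z ≟ x) ⟧) ⟩
      degIn A′ y + ∑[ z < M ] ⟦ does (z ≟ x) ⟧
        ≤⟨ +-monoʳ-≤ _ (∑⟦⟧≤1 (λ z → does (z ≟ x))
             λ z w p r → trans (does⇒ (z ≟ x) p) (sym (does⇒ (w ≟ x) r))) ⟩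
      degIn A′ y + 1                                        ∎
      where
      term : ∀ z → ⟦ A z ∧ R z y ⟧ ≤ ⟦ A′ z ∧ R z y ⟧ + ⟦ does (z ≟ x) ⟧
      term z with A z | does (z ≟ x)
      ... | false | _     = z≤n
      ... | true  | true  = ⟦⟧≤1 (R z y)
      ... | true  | false = m≤m+n _ 0
    dense′ : ∀ y → B′ y ≡ true → s + i * r ≤ r * degIn A′ y
    dense′ y B′y = +-cancelʳ-≤ r _ _ (begin
      s + i * r + r            ≡⟨ regroup s i r ⟩
      s + suc i * r            ≤⟨ dense y (proj₁ (∧-true B′y)) ⟩
      r * degIn A y            ≤⟨ *-monoʳ-≤ r (lose-one y) ⟩
      r * (degIn A′ y + 1)     ≡⟨ expand r (degIn A′ y) ⟩
      r * degIn A′ y + r       ∎)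
      where
      regroup : ∀ s i r → s + i * r + r ≡ s + suc i * r
      regroup = solve-∀
      expand : ∀ r x → r * (x + 1) ≡ r * x + r
      expand = solve-∀
    B′≥ : t * r ^ i ≤ card B′
    B′≥ = *-cancelˡ-≤ r {{>-nonZero r>0}} (begin
      r * (t * r ^ i)     ≡⟨ swap r t (r ^ i) ⟩
      t * r ^ suc i       ≤⟨ B≥ ⟩
      card B              ≤⟨ B≤ ⟩
      r * card B′         ∎)
      where
      swap : ∀ r t x → r * (t * x) ≡ t * (r * x)
      swap = solve-∀
  ... | φ , φ-inj , on , C , C≥ , common = ψ , ψ-inj , ψ-on , C , C≥ , λ y Cy →
    proj₁ (∧-true (proj₁ (common y Cy))) , ψ-common y Cy
    where
    ψ : Fin (suc i) → Fin M
    ψ zero    = x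
    ψ (suc k) = φ k
    φ≢x : ∀ k → φ k ≢ x
    φ≢x k eq with on k
    ... | h rewrite eq | does-≟-refl x with A x | h
    ...   | true  | ()
    ...   | false | ()
    ψ-inj : Injective _≡_ _≡_ ψ
    ψ-inj {zero}  {zero}  _  = refl
    ψ-inj {zero}  {suc k} eq = contradiction (sym eq) (φ≢x k)
    ψ-inj {suc k} {zero}  eq = contradiction eq (φ≢x k)
    ψ-inj {suc k} {suc l} eq = cong suc (φ-inj eq)
    ψ-on : ∀ k → A (ψ k) ≡ true
    ψ-on zero    = Ax
    ψ-on (suc k) = proj₁ (∧-true (on k))
    ψ-common : ∀ y → C y ≡ true → ∀ k → R (ψ k) y ≡ true
    ψ-common y Cy zero    = proj₂ (∧-true (proj₁ (common y Cy)))
    ψ-common y Cy (suc k) = proj₂ (common y Cy) k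

  -- Vertices of `B` below the degree threshold give the first term. More than t r^t vertices above
  -- it would yield t centres with t common neighbours, a biclique; so these are few, and each is
  -- charged the trivial degree s.
  biclique-free-edges : ∀ t (A : Fin M → Bool) (B : Fin N → Bool) s r → 0 < r → 0 < t →
    card A ≤ s → card B ≤ s → ¬ Biclique t t →
    r * ∑[ y < N ] (⟦ B y ⟧ * degIn A y) ≤ s * (s + t * r) + t * r ^ t * (r * s)
  biclique-free-edges t A B s r r>0 t>0 A≤s B≤s free = begin
    r * ∑[ y < N ] (⟦ B y ⟧ * degIn A y)
      ≡⟨ *-distribˡ-sum r (λ y → ⟦ B y ⟧ * degIn A y) ⟩
    ∑[ y < N ] (r * (⟦ B y ⟧ * degIn A y))
      ≤⟨ ∑-mono split ⟩
    ∑[ y < N ] (⟦ B y ⟧ * (s + t * r) + ⟦ heavy y ⟧ * (r * s))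
      ≡⟨ ∑-distrib-+ (λ y → ⟦ B y ⟧ * (s + t * r)) (λ y → ⟦ heavy y ⟧ * (r * s)) ⟩
    ∑[ y < N ] (⟦ B y ⟧ * (s + t * r)) + ∑[ y < N ] (⟦ heavy y ⟧ * (r * s))
      ≡⟨ cong₂ _+_ (*-distribʳ-sum (s + t * r) (λ y → ⟦ B y ⟧))
                   (*-distribʳ-sum (r * s) (λ y → ⟦ heavy y ⟧)) ⟨
    card B * (s + t * r) + card heavy * (r * s)
      ≤⟨ +-mono-≤ (*-monoˡ-≤ (s + t * r) B≤s) (*-monoˡ-≤ (r * s) few-heavy) ⟩
    s * (s + t * r) + t * r ^ t * (r * s)   ∎
    where
    open ≤-Reasoning
    heavy : Fin N → Bool
    heavy y = B y ∧ does (s + t * r ≤? r * degIn A y)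
    few-heavy : card heavy ≤ t * r ^ t
    few-heavy with card heavy ≤? t * r ^ t
    ... | yes le = le
    ... | no ¬le with find-star t t A heavy s r r>0 t>0 A≤s
                        (λ y h → does⇒ (s + t * r ≤? r * degIn A y) (proj₂ (∧-true h))) (<⇒≤ (≰⇒> ¬le))
    ...   | φ , φ-inj , _ , C , C≥ , common with enumerate C C≥
    ...     | ψ , ψ-inj , on =
      contradiction (φ , (λ {i} {j} → φ-inj {i} {j}) , ψ , (λ {i} {j} → ψ-inj {i} {j}) ,
                     λ i j → proj₂ (common (ψ j) (on j)) i) free
    degIn≤s : ∀ y → degIn A y ≤ s
    degIn≤s y = ≤-trans (card-∧ A (λ x → R x y)) A≤s
    split : ∀ y → r * (⟦ B y ⟧ * degIn A y) ≤ ⟦ B y ⟧ * (s + t * r) + ⟦ heavy y ⟧ * (r * s)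
    split y with B y
    ... | false = ≤-reflexive (*-zeroʳ r)
    -- `does` of the comparison in `heavy` reduces to this Boolean, so the split also evaluates
    -- `heavy y`.
    ... | true with s + t * r ≤ᵇ r * degIn A y in eq
    ...   | true = begin
      r * (1 * degIn A y)                  ≡⟨ cong (r *_) (*-identityˡ _) ⟩
      r * degIn A y                        ≤⟨ *-monoʳ-≤ r (degIn≤s y) ⟩
      r * s                                ≡⟨ *-identityˡ _ ⟨
      1 * (r * s)                          ≤⟨ m≤n+m _ (1 * (s + t * r)) ⟩
      1 * (s + t * r) + 1 * (r * s)        ∎
    ...   | false = begin
      r * (1 * degIn A y)                  ≡⟨ cong (r *_) (*-identityˡ _) ⟩
      r * degIn A y                        ≤⟨ <⇒≤ (≰⇒> λ le →
        contradiction (trans (sym eq) (dec-true (s + t * r ≤? r * degIn A y) le)) λ ()) ⟩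
      s + t * r                            ≡⟨ *-identityˡ _ ⟨
      1 * (s + t * r)                      ≤⟨ m≤m+n _ _ ⟩
      1 * (s + t * r) + 0                  ∎

-- Maximal matchings in a regular graph.

sum-tabulate : ∀ {A : Set} {n} (f : A → ℕ) (g : Fin n → A) → List.sum (map f (tabulate g)) ≡ sum (f ∘ g)
sum-tabulate {n = zero}  f g = refl
sum-tabulate {n = suc n} f g = cong (f (g zero) +_) (sum-tabulate f (g ∘ suc))

∨-trueˡ : ∀ {a} b → a ≡ true → a ∨ b ≡ true
∨-trueˡ b refl = refl

∨-trueʳ : ∀ a {b} → b ≡ true → a ∨ b ≡ true
∨-trueʳ a refl = ∨-zeroʳ a

∑-distrib₄ : ∀ {n} (f g h k : Fin n → ℕ) →
  ∑[ i < n ] ((f i + g i) + (h i + k i)) ≡ (sum f + sum g) + (sum h + sum k)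
∑-distrib₄ f g h k = trans (∑-distrib-+ (λ i → f i + g i) (λ i → h i + k i))
  (cong₂ _+_ (∑-distrib-+ f g) (∑-distrib-+ h k))

module _ {n : ℕ} (G : Graph n) where

  degree≡∑ : ∀ v → degree G v ≡ ∑[ w < n ] ⟦ adj G v w ⟧
  degree≡∑ v = sum-tabulate (λ w → ⟦ adj G v w ⟧) id

  record Matching : Set where
    field
      size     : ℕ
      edge     : Fin size → Fin n × Fin n
      adjacent : ∀ i → adj G (proj₁ (edge i)) (proj₂ (edge i)) ≡ true
      disjoint : ∀ i j a b → end (edge i) a ≡ end (edge j) b → i ≡ j

    Covers : Fin n → Set
    Covers v = ∃ λ i → proj₁ (edge i) ≡ v ⊎ proj₂ (edge i) ≡ v

    abstract
      covers? : ∀ v → Dec (Covers v)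
      covers? v = any? λ i → (proj₁ (edge i) ≟ v) ⊎-dec (proj₂ (edge i) ≟ v)

    covers-end : ∀ i a → Covers (end (edge i) a)
    covers-end i true  = i , inj₁ refl
    covers-end i false = i , inj₂ refl

  open Matching

  Meets : Matching → Fin n × Fin n → Set
  Meets M (u , v) = adj G u v ≡ true → Covers M u ⊎ Covers M v

  extend : (M : Matching) → ∀ u v → adj G u v ≡ true → ¬ Covers M u → ¬ Covers M v → Matching
  extend M u v uv ¬u ¬v = record
    { size     = suc (size M)
    ; edge     = edge′
    ; adjacent = λ { zero → uv ; (suc i) → adjacent M i }
    ; disjoint = disjoint′
    }
    where
    edge′ : Fin (suc (size M)) → Fin n × Fin n
    edge′ zero    = u , v
    edge′ (suc i) = edge M i
    fresh : ∀ a j b → end (u , v) a ≢ end (edge M j) b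
    fresh true  j b eq = ¬u (subst (Covers M) (sym eq) (covers-end M j b))
    fresh false j b eq = ¬v (subst (Covers M) (sym eq) (covers-end M j b))
    disjoint′ : ∀ i j a b → end (edge′ i) a ≡ end (edge′ j) b → i ≡ j
    disjoint′ zero    zero    a b eq = refl
    disjoint′ zero    (suc j) a b eq = contradiction eq (fresh a j b)
    disjoint′ (suc i) zero    a b eq = contradiction (sym eq) (fresh b i a)
    disjoint′ (suc i) (suc j) a b eq = cong suc (disjoint M i j a b eq)

  -- Adding an edge only enlarges the covered set, so pairs treated earlier remain met. Run over all
  -- ordered pairs, this gives maximality.
  greedy : (es : List (Fin n × Fin n)) → Σ Matching λ M → All (Meets M) es
  greedy [] = record { size = 0 ; edge = λ () ; adjacent = λ () ; disjoint = λ () } , []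
  greedy ((u , v) ∷ es) with greedy es
  ... | M , meets with adj G u v in uv | covers? M u | covers? M v
  ...   | false | _      | _      = M , (λ p → contradiction (trans (sym p) uv) λ ()) ∷ meets
  ...   | true  | yes cu | _      = M , (λ _ → inj₁ cu) ∷ meets
  ...   | true  | no _   | yes cv = M , (λ _ → inj₂ cv) ∷ meets
  ...   | true  | no ¬u  | no ¬v  =
    extend M u v uv ¬u ¬v ,
    (λ _ → inj₁ (zero , inj₁ refl)) ∷ All.map (λ meet p → map-⊎ shift shift (meet p)) meets
    where
    shift : ∀ {w} → Covers M w → Covers (extend M u v uv ¬u ¬v) w
    shift (i , p) = suc i , p

  maximal-matching : Σ Matching λ M → ∀ u v → Meets M (u , v)
  maximal-matching with greedy (cartesianProduct (allFin n) (allFin n))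
  ... | M , meets = M , λ u v → All.lookup meets (∈-cartesianProduct⁺ (∈-allFin u) (∈-allFin v))

  module _ (d : ℕ) (regular : Regular G d) where

    degree≡d : ∀ v → ∑[ w < n ] ⟦ adj G v w ⟧ ≡ d
    degree≡d v = trans (sym (degree≡∑ v)) (regular v)

    -- Each of the nd ordered adjacent pairs has a covered end by maximality. At most 2|M| vertices
    -- are covered, and each is charged d times as first and d times as second member.
    large-matching : .{{_ : NonZero d}} → (M : Matching) → (∀ u v → Meets M (u , v)) → n ≤ 4 * size M
    large-matching M meets = *-cancelˡ-≤ d (begin
      d * n                                                     ≡⟨ *-comm d n ⟩
      n * d                                                     ≡⟨ ∑-const n d ⟨
      ∑[ u < n ] d                                              ≡⟨ sum-cong-≗ degree≡d ⟨
      ∑[ u < n ] ∑[ v < n ] ⟦ adj G u v ⟧                       ≤⟨ ∑-mono (λ u → ∑-mono (λ v → charge u v)) ⟩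
      ∑[ u < n ] ∑[ v < n ] (κ u * ⟦ adj G u v ⟧ + κ v * ⟦ adj G u v ⟧)
        ≡⟨ sum-cong-≗ (λ u → ∑-distrib-+ (λ v → κ u * ⟦ adj G u v ⟧) (λ v → κ v * ⟦ adj G u v ⟧)) ⟩
      ∑[ u < n ] (∑[ v < n ] (κ u * ⟦ adj G u v ⟧) + ∑[ v < n ] (κ v * ⟦ adj G u v ⟧))
        ≡⟨ ∑-distrib-+ (λ u → ∑[ v < n ] (κ u * ⟦ adj G u v ⟧)) (λ u → ∑[ v < n ] (κ v * ⟦ adj G u v ⟧)) ⟩
      ∑[ u < n ] ∑[ v < n ] (κ u * ⟦ adj G u v ⟧) + ∑[ u < n ] ∑[ v < n ] (κ v * ⟦ adj G u v ⟧)
        ≡⟨ cong (∑[ u < n ] ∑[ v < n ] (κ u * ⟦ adj G u v ⟧) +_) (trans (∑-comm (λ u v → κ v * ⟦ adj G u v ⟧))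
             (sum-cong-≗ λ v → sum-cong-≗ λ u → cong (λ b → κ v * ⟦ b ⟧) (Defs.sym G u v))) ⟩
      ∑[ u < n ] ∑[ v < n ] (κ u * ⟦ adj G u v ⟧) + ∑[ u < n ] ∑[ v < n ] (κ u * ⟦ adj G u v ⟧)
        ≡⟨ cong₂ _+_ degrees degrees ⟩
      sum κ * d + sum κ * d                                     ≤⟨ +-mono-≤ (*-monoˡ-≤ d κ≤) (*-monoˡ-≤ d κ≤) ⟩
      size M * 2 * d + size M * 2 * d                           ≡⟨ regroup (size M) d ⟩
      d * (4 * size M)                                          ∎)
      where
      open ≤-Reasoning
      κ : Fin n → ℕ
      κ u = ⟦ does (covers? M u) ⟧
      regroup : ∀ s d → s * 2 * d + s * 2 * d ≡ d * (4 * s)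
      regroup = solve-∀
      degrees : ∑[ u < n ] ∑[ v < n ] (κ u * ⟦ adj G u v ⟧) ≡ sum κ * d
      degrees = trans
        (sum-cong-≗ λ u → trans (sym (*-distribˡ-sum (κ u) (λ v → ⟦ adj G u v ⟧))) (cong (κ u *_) (degree≡d u)))
        (sym (*-distribʳ-sum d κ))
      κ-true : ∀ u → Covers M u → κ u ≡ 1
      κ-true u cu = cong ⟦_⟧ (dec-true (covers? M u) cu)
      charge : ∀ u v → ⟦ adj G u v ⟧ ≤ κ u * ⟦ adj G u v ⟧ + κ v * ⟦ adj G u v ⟧
      charge u v with adj G u v in uv
      ... | false = z≤n
      ... | true with meets u v uv
      ...   | inj₁ cu = ≤-trans (≤-reflexive (sym (trans (*-identityʳ (κ u)) (κ-true u cu)))) (m≤m+n _ _)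
      ...   | inj₂ cv = ≤-trans (≤-reflexive (sym (trans (*-identityʳ (κ v)) (κ-true v cv)))) (m≤n+m _ _)
      hits : Fin n → Fin (size M) → ℕ
      hits u i = ⟦ does (u ≟ proj₁ (edge M i)) ⟧ + ⟦ does (u ≟ proj₂ (edge M i)) ⟧
      κ≤hits : ∀ u → κ u ≤ ∑[ i < size M ] hits u i
      κ≤hits u with covers? M u
      ... | no _ = z≤n
      ... | yes (i , inj₁ refl) =
        ≤-trans (≤-trans (≤-reflexive (sym (cong ⟦_⟧ (does-≟-refl u)))) (m≤m+n _ _)) (term≤∑ (hits u) i)
      ... | yes (i , inj₂ refl) =
        ≤-trans (≤-trans (≤-reflexive (sym (cong ⟦_⟧ (does-≟-refl u)))) (m≤n+m _ _)) (term≤∑ (hits u) i)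
      one : ∀ w → ∑[ u < n ] ⟦ does (u ≟ w) ⟧ ≤ 1
      one w = ∑⟦⟧≤1 (λ u → does (u ≟ w)) λ i j p q → trans (does⇒ (i ≟ w) p) (sym (does⇒ (j ≟ w) q))
      κ≤ : sum κ ≤ size M * 2
      κ≤ = begin
        sum κ                                      ≤⟨ ∑-mono κ≤hits ⟩
        ∑[ u < n ] ∑[ i < size M ] hits u i        ≡⟨ ∑-comm hits ⟩
        ∑[ i < size M ] ∑[ u < n ] hits u i        ≤⟨ ∑-mono (λ i → ≤-trans
          (≤-reflexive (∑-distrib-+ (λ u → ⟦ does (u ≟ proj₁ (edge M i)) ⟧) (λ u → ⟦ does (u ≟ proj₂ (edge M i)) ⟧)))
          (+-mono-≤ (one _) (one _))) ⟩
        ∑[ i < size M ] 2                          ≡⟨ ∑-const (size M) 2 ⟩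
        size M * 2                                 ∎

  -- The conflict graph of a matching and its local sparsity.

  module Conflict (M : Matching) where

    N = size M

    e : Fin N → Bool → Fin n
    e i = end (edge M i)

    linked : Bool → Bool → Fin N → Fin N → Bool
    linked a b i j = adj G (e i a) (e j b)

    -- Grouped so that exchanging `i` and `j` fixes the first pair of relations and swaps the second
    -- pair.
    near : Fin N → Fin N → Bool
    near i j = (linked true true i j ∨ linked false false i j) ∨ (linked true false i j ∨ linked false true i j)

    -- The diagonal must be removed explicitly, since the two ends of one edge are adjacent and so
    -- every edge is linked to itself.
    conflict : Fin N → Fin N → Bool
    conflict i j = not (does (i ≟ j)) ∧ near i j

    linked-sym : ∀ a b i j → linked a b i j ≡ linked b a j i
    linked-sym a b i j = Defs.sym G (e i a) (e j b)

    conflict-sym : ∀ i j → conflict i j ≡ conflict j i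
    conflict-sym i j = cong₂ _∧_
      (cong not (does-⇔ (mk⇔ sym sym) (i ≟ j) (j ≟ i)))
      (cong₂ _∨_ (cong₂ _∨_ (linked-sym true true i j) (linked-sym false false i j))
        (trans (cong₂ _∨_ (linked-sym true false i j) (linked-sym false true i j))
          (∨-comm (linked false true j i) (linked true false j i))))

    conflict-irrefl : ∀ i → conflict i i ≡ false
    conflict-irrefl i rewrite does-≟-refl i = refl

    linked⇒conflict : ∀ a b i j → i ≢ j → linked a b i j ≡ true → conflict i j ≡ true
    linked⇒conflict a b i j i≢j l rewrite dec-false (i ≟ j) i≢j = near-true a b l
      where
      near-true : ∀ a b → linked a b i j ≡ true → near i j ≡ true
      near-true true  true  p = ∨-trueˡ _ (∨-trueˡ (linked false false i j) p)
      near-true false false p = ∨-trueˡ _ (∨-trueʳ (linked true true i j) p)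
      near-true true  false p = ∨-trueʳ (linked true true i j ∨ _) (∨-trueˡ (linked false true i j) p)
      near-true false true  p = ∨-trueʳ (linked true true i j ∨ _) (∨-trueʳ (linked true false i j) p)

    conflict≤linked : ∀ i j → ⟦ conflict i j ⟧ ≤
      (⟦ linked true true i j ⟧ + ⟦ linked false false i j ⟧)
        + (⟦ linked true false i j ⟧ + ⟦ linked false true i j ⟧)
    conflict≤linked i j = ≤-trans (drop (not (does (i ≟ j))) (near i j))
      (≤-trans (union (linked true true i j ∨ linked false false i j) _)
        (+-mono-≤ (union (linked true true i j) _) (union (linked true false i j) _)))
      where
      drop : ∀ a b → ⟦ a ∧ b ⟧ ≤ ⟦ b ⟧
      drop true  b = ≤-refl
      drop false b = z≤n
      union : ∀ a b → ⟦ a ∨ b ⟧ ≤ ⟦ a ⟧ + ⟦ b ⟧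
      union true  b = m≤m+n 1 ⟦ b ⟧
      union false b = ≤-refl

    open HardCore conflict conflict-sym conflict-irrefl

    induced-matching : ∀ I → Independent I → HasInducedMatchingOfSize G (∑[ u < N ] ⟦ lookup I u ⟧)
    induced-matching I indep with enumerate (lookup I) ≤-refl
    ... | φ , inj , on = edge M ∘ φ , (λ i → adjacent M (φ i)) , λ i j i≢j a b →
      (λ eq → i≢j (inj (disjoint M (φ i) (φ j) a b eq))) , ¬-not λ l →
      contradiction (trans (sym (linked⇒conflict a b (φ i) (φ j) (i≢j ∘ inj) l))
                           (indep (φ i) (φ j) (on i) (on j))) λ ()

    module _ (d : ℕ) (regular : Regular G d) where
      open ≤-Reasoning

      linked-degree : ∀ a b i → ∑[ j < N ] ⟦ linked a b i j ⟧ ≤ d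
      linked-degree a b i = ≤-trans
        (∑-injective (λ j → e j b) (λ {j} {k} → disjoint M j k b b) (λ w → ⟦ adj G (e i a) w ⟧))
        (≤-reflexive (degree≡d d regular (e i a)))

      conflict-degree : ∀ i → ∑[ j < N ] ⟦ conflict i j ⟧ ≤ 4 * d
      conflict-degree i = begin
        ∑[ j < N ] ⟦ conflict i j ⟧                 ≤⟨ ∑-mono (conflict≤linked i) ⟩
        ∑[ j < N ] ((L true true j + L false false j) + (L true false j + L false true j))
          ≡⟨ ∑-distrib₄ (L true true) (L false false) (L true false) (L false true) ⟩
        (sum (L true true) + sum (L false false)) + (sum (L true false) + sum (L false true))
          ≤⟨ +-mono-≤ (+-mono-≤ (linked-degree true true i) (linked-degree false false i))
                      (+-mono-≤ (linked-degree true false i) (linked-degree false true i)) ⟩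
        (d + d) + (d + d)                           ≡⟨ four d ⟩
        4 * d                                       ∎
        where
        L : Bool → Bool → Fin N → ℕ
        L a b j = ⟦ linked a b i j ⟧
        four : ∀ d → (d + d) + (d + d) ≡ 4 * d
        four = solve-∀

      -- A conflict inside the neighbourhood of `v` is one of four links, and each link relation is
      -- biclique-free, so the bound above applies four times with s = 4d; the choice w = v adds the
      -- degree of `v`. Since r and r^(t+1) are at most d, every term is of order d², which gives 4
      -- + 64 and 16t + 16t.
      sparse : ∀ t r → 0 < t → 0 < r → r * r ^ t ≤ d →
        (∀ a b → ¬ Incidence.Biclique (λ i j → linked a b j i) t t) →
        ∀ v → r * triangles v ≤ (68 + 32 * t) * (d * d)
      sparse t r t>0 r>0 r^≤d free v = begin
        r * triangles v
          ≤⟨ *-monoʳ-≤ r (∑-mono λ u → *-monoʳ-≤ (κ u) (common-conflicts u)) ⟩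
        r * ∑[ u < N ] (κ u * (1 + ((D true true u + D false false u) + (D true false u + D false true u))))
          ≡⟨ cong (r *_) (trans
               (sum-cong-≗ λ u → spread (κ u) (D true true u) (D false false u) (D true false u) (D false true u))
               (trans (∑-distrib-+ κ _) (cong (sum κ +_)
                 (∑-distrib₄ (S true true) (S false false) (S true false) (S false true))))) ⟩
        r * (sum κ + ((sum (S true true) + sum (S false false)) + (sum (S true false) + sum (S false true))))
          ≡⟨ expand r (sum κ) (sum (S true true)) (sum (S false false)) (sum (S true false)) (sum (S false true)) ⟩
        r * sum κ + ((r * sum (S true true) + r * sum (S false false))
                     + (r * sum (S true false) + r * sum (S false true)))
          ≤⟨ +-mono-≤ (*-monoʳ-≤ r (conflict-degree v))
               (+-mono-≤ (+-mono-≤ (edges true true) (edges false false))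
                         (+-mono-≤ (edges true false) (edges false true))) ⟩
        r * (4 * d) + ((X + X) + (X + X))
          ≡⟨ collect r d t (r ^ t) ⟩
        (4 * d + 16 * t * d) * r + (64 * d * d + 16 * t * d * (r * r ^ t))
          ≤⟨ +-mono-≤ (*-monoʳ-≤ (4 * d + 16 * t * d) r≤d) (+-monoʳ-≤ (64 * d * d) (*-monoʳ-≤ (16 * t * d) r^≤d)) ⟩
        (4 * d + 16 * t * d) * d + (64 * d * d + 16 * t * d * d)
          ≡⟨ total d t ⟩
        (68 + 32 * t) * (d * d)   ∎
        where
        r≤d : r ≤ d
        r≤d = ≤-trans (m≤m*n r (r ^ t) {{m^n≢0 r t {{>-nonZero r>0}}}}) r^≤d
        κ : Fin N → ℕ
        κ u = ⟦ conflict v u ⟧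
        D S : Bool → Bool → Fin N → ℕ
        D a b u = card λ w → conflict v w ∧ linked a b u w
        S a b u = κ u * D a b u
        X = 4 * d * (4 * d + t * r) + t * r ^ t * (r * (4 * d))
        edges : ∀ a b → r * sum (S a b) ≤ X
        edges a b = Incidence.biclique-free-edges
          (λ i j → linked a b j i) t (conflict v) (conflict v) (4 * d) r r>0 t>0
          (conflict-degree v) (conflict-degree v) (free a b)
        common-conflicts : ∀ u → ∑[ w < N ] ⟦ conflict u w ∧ ball v w ⟧
          ≤ 1 + ((D true true u + D false false u) + (D true false u + D false true u))
        common-conflicts u = begin
          ∑[ w < N ] ⟦ conflict u w ∧ ball v w ⟧   ≤⟨ ∑-mono term ⟩
          ∑[ w < N ] (⟦ does (w ≟ v) ⟧ + ((T true true w + T false false w) + (T true false w + T false true w)))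
            ≡⟨ trans (∑-distrib-+ (λ w → ⟦ does (w ≟ v) ⟧) _)
                 (cong (sum (λ w → ⟦ does (w ≟ v) ⟧) +_)
                   (∑-distrib₄ (T true true) (T false false) (T true false) (T false true))) ⟩
          ∑[ w < N ] ⟦ does (w ≟ v) ⟧ + ((D true true u + D false false u) + (D true false u + D false true u))
            ≤⟨ +-monoˡ-≤ _ (∑⟦⟧≤1 (λ w → does (w ≟ v))
                 λ i j p q → trans (does⇒ (i ≟ v) p) (sym (does⇒ (j ≟ v) q))) ⟩
          1 + ((D true true u + D false false u) + (D true false u + D false true u))   ∎
          where
          T : Bool → Bool → Fin N → ℕ
          T a b w = ⟦ conflict v w ∧ linked a b u w ⟧
          term : ∀ w → ⟦ conflict u w ∧ ball v w ⟧ ≤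
            ⟦ does (w ≟ v) ⟧ + ((T true true w + T false false w) + (T true false w + T false true w))
          term w with does (w ≟ v) | conflict v w
          ... | true  | _     = ≤-trans (⟦⟧≤1 (conflict u w ∧ true)) (m≤m+n 1 _)
          ... | false | true  = ≤-trans (≤-reflexive (cong ⟦_⟧ (∧-identityʳ (conflict u w)))) (conflict≤linked u w)
          ... | false | false = ≤-reflexive (cong ⟦_⟧ (∧-zeroʳ (conflict u w)))
        spread : ∀ k a b c e → k * (1 + ((a + b) + (c + e))) ≡ k + ((k * a + k * b) + (k * c + k * e))
        spread = solve-∀
        expand : ∀ r k a b c e → r * (k + ((a + b) + (c + e))) ≡ r * k + ((r * a + r * b) + (r * c + r * e))
        expand = solve-∀
        collect : ∀ r d t p → r * (4 * d)
          + ((4 * d * (4 * d + t * r) + t * p * (r * (4 * d)) + (4 * d * (4 * d + t * r) + t * p * (r * (4 * d))))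
            + (4 * d * (4 * d + t * r) + t * p * (r * (4 * d)) + (4 * d * (4 * d + t * r) + t * p * (r * (4 * d)))))
          ≡ (4 * d + 16 * t * d) * r + (64 * d * d + 16 * t * d * (r * p))
        collect = solve-∀
        total : ∀ d t → (4 * d + 16 * t * d) * d + (64 * d * d + 16 * t * d * d) ≡ (68 + 32 * t) * (d * d)
        total = solve-∀

-- Binary logarithms and floor division.

n<2^n : ∀ n → n < 2 ^ n
n<2^n zero    = s≤s z≤n
n<2^n (suc n) = ≤-trans (+-mono-≤ (m^n>0 2 n) (n<2^n n)) (+-monoʳ-≤ (2 ^ n) (m≤m+n (2 ^ n) 0))

-- Abstract, so that the large constants of the final theorem are not unfolded to unary numerals.
abstract
  exponent : ∀ a → ∃ λ γ → a ≤ 2 ^ γ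
  exponent a = a , <⇒≤ (n<2^n a)

2^⌊log₂n⌋≤n : ∀ n → 1 ≤ n → 2 ^ ⌊log₂ n ⌋ ≤ n
2^⌊log₂n⌋≤n = <-rec _ step
  where
  open ≤-Reasoning
  step : ∀ n → (∀ {m} → m < n → 1 ≤ m → 2 ^ ⌊log₂ m ⌋ ≤ m) → 1 ≤ n → 2 ^ ⌊log₂ n ⌋ ≤ n
  step (suc zero)          rec _ = s≤s z≤n
  step n@(suc (suc n′)) rec _ = begin
    2 ^ ⌊log₂ n ⌋                   ≤⟨ ^-monoʳ-≤ 2 (m≤n+m∸n ⌊log₂ n ⌋ 1) ⟩
    2 * 2 ^ (⌊log₂ n ⌋ ∸ 1)         ≡⟨ cong (λ l → 2 * 2 ^ l) (⌊log₂⌊n/2⌋⌋≡⌊log₂n⌋∸1 n) ⟨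
    2 * 2 ^ ⌊log₂ ⌊ n /2⌋ ⌋         ≤⟨ *-monoʳ-≤ 2 (rec (⌊n/2⌋<n (suc n′)) (s≤s z≤n)) ⟩
    2 * ⌊ n /2⌋                     ≡⟨ cong (⌊ n /2⌋ +_) (+-identityʳ _) ⟩
    ⌊ n /2⌋ + ⌊ n /2⌋               ≤⟨ +-monoʳ-≤ ⌊ n /2⌋ (⌊n/2⌋≤⌈n/2⌉ n) ⟩
    ⌊ n /2⌋ + ⌈ n /2⌉               ≡⟨ ⌊n/2⌋+⌈n/2⌉≡n n ⟩
    n                               ∎

m≤2*[m/n]*n : ∀ m n .{{_ : NonZero n}} → 1 ≤ m / n → m ≤ 2 * (m / n) * n
m≤2*[m/n]*n m n q≥1 = begin
  m                          ≡⟨ m≡m%n+[m/n]*n m n ⟩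
  m % n + m / n * n          ≤⟨ +-monoˡ-≤ _ (<⇒≤ (m%n<n m n)) ⟩
  n + m / n * n              ≡⟨ cong (_+ m / n * n) (*-identityˡ n) ⟨
  1 * n + m / n * n          ≤⟨ +-monoˡ-≤ _ (*-monoˡ-≤ n q≥1) ⟩
  m / n * n + m / n * n      ≡⟨ double (m / n) n ⟩
  2 * (m / n) * n            ∎
  where
  open ≤-Reasoning
  double : ∀ q n → q * n + q * n ≡ 2 * q * n
  double = solve-∀

-- Placing H in a biclique, and the choice of parameters.

module _ {n : ℕ} (G : Graph n) (M : Matching G) where
  open Matching M
  open Conflict G M
  open HardCore conflict conflict-sym conflict-irrefl

  -- Vertex x of H goes to position x on the side given by its colour, so both sides need B
  -- vertices. The two index families may share matching edges, but the vertices on opposite sides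
  -- are adjacent in G and hence distinct, as G has no loops.
  biclique⇒subgraph : ∀ {B} (H : Graph B) → IsBipartite H → ∀ a b →
    Incidence.Biclique (λ i j → linked a b j i) B B → ContainsSubgraph G H
  biclique⇒subgraph {B} H (f , proper) a b (φ , φ-inj , ψ , ψ-inj , complete) = ξ , ξ-inj , ξ-hom
    where
    side : Bool → Fin B → Fin n
    side true  x = e (ψ x) a
    side false x = e (φ x) b
    ξ : Fin B → Fin n
    ξ x = side (f x) x
    sides-apart : ∀ x y → side true x ≢ side false y
    sides-apart x y eq = contradiction
      (trans (sym (complete y x)) (trans (cong (λ z → adj G z (e (φ y) b)) eq) (irrefl G (e (φ y) b)))) λ ()
    ξ-inj′ : ∀ p q x y → side p x ≡ side q y → x ≡ y
    ξ-inj′ true  true  x y eq = ψ-inj (disjoint (ψ x) (ψ y) a a eq)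
    ξ-inj′ true  false x y eq = contradiction eq (sides-apart x y)
    ξ-inj′ false true  x y eq = contradiction (sym eq) (sides-apart y x)
    ξ-inj′ false false x y eq = φ-inj (disjoint (φ x) (φ y) b b eq)
    ξ-inj : Injective _≡_ _≡_ ξ
    ξ-inj {x} {y} = ξ-inj′ (f x) (f y) x y
    hom : ∀ p q x y → p ≢ q → adj G (side p x) (side q y) ≡ true
    hom true  true  x y p≢q = contradiction refl p≢q
    hom true  false x y p≢q = complete y x
    hom false true  x y p≢q = trans (Defs.sym G (e (φ x) b) (e (ψ y) a)) (complete x y)
    hom false false x y p≢q = contradiction refl p≢q
    ξ-hom : ∀ x y → adj H x y ≡ true → adj G (ξ x) (ξ y) ≡ true
    ξ-hom x y xy = hom (f x) (f y) x y (proper x y xy)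

  module _ (d : ℕ) (regular : Regular G d) where

    independent⇒matching : ∀ A C → (∃ λ I → Independent I × A ≤ C * ∑[ u < size ] ⟦ lookup I u ⟧) →
      ∃ λ s → HasInducedMatchingOfSize G s × A ≤ C * s
    independent⇒matching A C (I , indep , large) = ∑[ u < size ] ⟦ lookup I u ⟧ , induced-matching I indep , large

    -- Fugacity one: q = 1 and m = 2, whence 2 + 4d.
    trivial-matching : ∃ λ s → HasInducedMatchingOfSize G s × size ≤ (2 + 4 * d) * s
    trivial-matching = independent⇒matching size (2 + 4 * d)
      (Weights.large-independent 1 size (2 + 4 * d)
        (Weights.trivial-occupancy 1 (4 * d) (conflict-degree d regular)))

    -- The weight is q = 2k - 1, so that m = 2k; splitting off a successor from k writes it without
    -- subtraction and shows that it is nonzero.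
    log-matching : ∀ k j .{{_ : NonZero k}} → k * (j * 2 ^ j) ≤ 4 * d → (∀ v → triangles v ≤ k * (k * j)) →
      ∃ λ s → HasInducedMatchingOfSize G s × size * j ≤ 8 * (4 * d) * s
    log-matching (suc k) j kj≤ tri = independent⇒matching (size * j) (8 * (4 * d))
      (Weights.large-independent (suc (2 * k)) (size * j) (8 * (4 * d))
        (Weights.occupancy (suc (2 * k)) (4 * d) (conflict-degree d regular) (suc k) j (even k) kj≤ tri))
      where
      even : ∀ k → suc (suc (2 * k)) ≡ 2 * suc k
      even = solve-∀

    -- With P = 4^j and k the floor of d/P, the bound j < 2^j gives k j 2^j ≤ kP ≤ d. Local edge
    -- counts are at most C d²/r with C = 68 + 32B, and d ≤ 2kP turns this into 4C P² k²/r. So r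
    -- must be at least 4C · 16^j, which is the origin of 2^(4j + γ).
    sparse-matching : ∀ {B} (H : Graph B) → 0 < B → IsBipartite H → ¬ ContainsSubgraph G H →
      ∀ γ → 4 * (68 + 32 * B) ≤ 2 ^ γ → ∀ j → 1 ≤ j → (2 ^ (4 * j + γ)) ^ suc B ≤ d →
      ∃ λ s → HasInducedMatchingOfSize G s × size * j ≤ 8 * (4 * d) * s
    sparse-matching {B} H B>0 bip H-free γ C≤ j j≥1 r^≤d = log-matching k j {{>-nonZero k≥1}} kj≤ tri
      where
      open ≤-Reasoning
      r = 2 ^ (4 * j + γ)
      P = 2 ^ j * 2 ^ j
      instance
        P≢0 : NonZero P
        P≢0 = m*n≢0 (2 ^ j) (2 ^ j) {{m^n≢0 2 j}} {{m^n≢0 2 j}}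
        r≢0 : NonZero r
        r≢0 = m^n≢0 2 (4 * j + γ)
      r≡ : r ≡ 2 ^ γ * (P * P)
      r≡ = trans (^-distribˡ-+-* 2 (4 * j) γ) (trans (*-comm (2 ^ (4 * j)) (2 ^ γ)) (cong (2 ^ γ *_)
        (trans (cong (2 ^_) (four j)) (trans (^-distribˡ-+-* 2 (j + j) (j + j))
          (cong₂ _*_ (^-distribˡ-+-* 2 j j) (^-distribˡ-+-* 2 j j))))))
        where
        four : ∀ j → 4 * j ≡ (j + j) + (j + j)
        four = solve-∀
      P≤d : P ≤ d
      P≤d = begin
        P                  ≤⟨ m≤m*n P P ⟩
        P * P              ≤⟨ m≤n*m (P * P) (2 ^ γ) {{m^n≢0 2 γ}} ⟩
        2 ^ γ * (P * P)    ≡⟨ r≡ ⟨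
        r                  ≤⟨ m≤m*n r (r ^ B) {{m^n≢0 r B}} ⟩
        r ^ suc B          ≤⟨ r^≤d ⟩
        d                  ∎
      k = d / P
      k≥1 : 1 ≤ k
      k≥1 = m≥n⇒m/n>0 P≤d
      kj≤ : k * (j * 2 ^ j) ≤ 4 * d
      kj≤ = begin
        k * (j * 2 ^ j)    ≤⟨ *-monoʳ-≤ k (*-monoˡ-≤ (2 ^ j) (<⇒≤ (n<2^n j))) ⟩
        k * P              ≤⟨ m/n*n≤m d P ⟩
        d                  ≤⟨ m≤n*m d 4 ⟩
        4 * d              ∎
      d≤ : d ≤ 2 * k * P
      d≤ = m≤2*[m/n]*n d P k≥1
      tri : ∀ v → triangles v ≤ k * (k * j)
      tri v = *-cancelˡ-≤ r (begin
        r * triangles v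
          ≤⟨ sparse d regular B r B>0 (>-nonZero⁻¹ r) r^≤d (λ a b → H-free ∘ biclique⇒subgraph H bip a b) v ⟩
        (68 + 32 * B) * (d * d)                         ≤⟨ *-monoʳ-≤ (68 + 32 * B) (*-mono-≤ d≤ d≤) ⟩
        (68 + 32 * B) * (2 * k * P * (2 * k * P))       ≡⟨ regroup (68 + 32 * B) k P ⟩
        4 * (68 + 32 * B) * (P * P) * (k * (k * 1))
          ≤⟨ *-mono-≤ (*-monoˡ-≤ (P * P) C≤) (*-monoʳ-≤ k (*-monoʳ-≤ k j≥1)) ⟩
        2 ^ γ * (P * P) * (k * (k * j))     ≡⟨ cong (_* (k * (k * j))) r≡ ⟨
        r * (k * (k * j))                   ∎)
        where
        regroup : ∀ C k P → C * (2 * k * P * (2 * k * P)) ≡ 4 * C * (P * P) * (k * (k * 1))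
        regroup = solve-∀

-- Here j is the floor of ⌊log₂ d⌋ / K. If j = 0 the logarithm is below the constant K and fugacity
-- one suffices. Otherwise 256 = 4 · 2 · 32 collects n ≤ 4N, the loss in the floor, and the factor 8
-- · 4d of the logarithmic estimate.
matching-bound : ∀ {B} (H : Graph B) → 0 < B → IsBipartite H → ∀ γ → 4 * (68 + 32 * B) ≤ 2 ^ γ →
  ∀ K .{{_ : NonZero K}} → K ≡ (4 + γ) * suc B →
  ∀ n d → 1 ≤ d → (G : Graph n) → Regular G d → ¬ ContainsSubgraph G H →
  ∃ λ s → HasInducedMatchingOfSize G s × n * ⌊log₂ d ⌋ ≤ 256 * K * d * s
matching-bound {B} H B>0 bip γ C≤ K K≡ n d d≥1 G regular H-free =
  by-cases (⌊log₂ d ⌋ / K) refl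
  where
  open ≤-Reasoning
  M = proj₁ (maximal-matching G)
  N = Matching.size M
  l = ⌊log₂ d ⌋
  n≤4N : n ≤ 4 * N
  n≤4N = large-matching G d regular {{>-nonZero d≥1}} M (proj₂ (maximal-matching G))

  small-degree : l < K → ∀ s → N ≤ (2 + 4 * d) * s → n * l ≤ 256 * K * d * s
  small-degree l<K s N≤ = begin
    n * l                                  ≤⟨ *-mono-≤ n≤4N (<⇒≤ l<K) ⟩
    4 * N * K                              ≤⟨ *-monoˡ-≤ K (*-monoʳ-≤ 4 N≤) ⟩
    4 * ((2 * 1 + 4 * d) * s) * K
      ≤⟨ *-monoˡ-≤ K (*-monoʳ-≤ 4 (*-monoˡ-≤ s (+-monoˡ-≤ (4 * d) (*-monoʳ-≤ 2 d≥1)))) ⟩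
    4 * ((2 * d + 4 * d) * s) * K          ≡⟨ regroup d s K ⟩
    24 * (K * d * s)                       ≤⟨ *-monoˡ-≤ (K * d * s) (≤ᵇ⇒≤ 24 256 _) ⟩
    256 * (K * d * s)                      ≡⟨ reassoc K d s ⟩
    256 * K * d * s                        ∎
    where
    regroup : ∀ d s K → 4 * ((2 * d + 4 * d) * s) * K ≡ 24 * (K * d * s)
    regroup = solve-∀
    reassoc : ∀ K d s → 256 * (K * d * s) ≡ 256 * K * d * s
    reassoc = solve-∀

  powers : ∀ j .{{_ : NonZero j}} → l / K ≡ j → (2 ^ (4 * j + γ)) ^ suc B ≤ d
  powers j eq = begin
    (2 ^ (4 * j + γ)) ^ suc B       ≡⟨ ^-*-assoc 2 (4 * j + γ) (suc B) ⟩
    2 ^ ((4 * j + γ) * suc B)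
      -- As j ≥ 1, γ is at most jγ, so the whole exponent is at most j · K; this dictates K = (4 +
      -- γ)(B + 1).
      ≤⟨ ^-monoʳ-≤ 2 (*-monoˡ-≤ (suc B) (+-mono-≤ (≤-reflexive (*-comm 4 j)) (m≤n*m γ j))) ⟩
    2 ^ ((j * 4 + j * γ) * suc B)
      ≡⟨ cong (2 ^_) (trans (factor j γ (suc B)) (cong (j *_) (sym K≡))) ⟩
    2 ^ (j * K)                     ≡⟨ cong (λ i → 2 ^ (i * K)) eq ⟨
    2 ^ (l / K * K)                 ≤⟨ ^-monoʳ-≤ 2 (m/n*n≤m l K) ⟩
    2 ^ l                           ≤⟨ 2^⌊log₂n⌋≤n d d≥1 ⟩
    d                               ∎
    where
    factor : ∀ j g b → (j * 4 + j * g) * b ≡ j * ((4 + g) * b)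
    factor = solve-∀

  large-degree : ∀ j → 1 ≤ j → l / K ≡ j → ∀ s → N * j ≤ 8 * (4 * d) * s → n * l ≤ 256 * K * d * s
  large-degree j j≥1 eq s Nj≤ = begin
    n * l                          ≤⟨ *-mono-≤ n≤4N (m≤2*[m/n]*n l K (subst (1 ≤_) (sym eq) j≥1)) ⟩
    4 * N * (2 * (l / K) * K)      ≡⟨ cong (λ i → 4 * N * (2 * i * K)) eq ⟩
    4 * N * (2 * j * K)            ≡⟨ regroup N j K ⟩
    8 * K * (N * j)                ≤⟨ *-monoʳ-≤ (8 * K) Nj≤ ⟩
    8 * K * (8 * (4 * d) * s)      ≡⟨ collect K d s ⟩
    256 * K * d * s                ∎
    where
    regroup : ∀ N j K → 4 * N * (2 * j * K) ≡ 8 * K * (N * j)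
    regroup = solve-∀
    collect : ∀ K d s → 8 * K * (8 * (4 * d) * s) ≡ 256 * K * d * s
    collect = solve-∀

  by-cases : ∀ j → l / K ≡ j → ∃ λ s → HasInducedMatchingOfSize G s × n * l ≤ 256 * K * d * s
  by-cases zero eq =
    map₂ (λ {s} → map₂ (small-degree (m/n≡0⇒m<n eq) s)) (trivial-matching G M d regular)
  by-cases j@(suc _) eq =
    map₂ (λ {s} → map₂ (large-degree j (s≤s z≤n) eq s))
      (sparse-matching G M d regular H B>0 bip H-free γ C≤ j (s≤s z≤n) (powers j eq))

theorem2 : ∀ {B : ℕ} (H : Graph B) → 2 < B → IsBipartite H →
    Σ ℕ λ p → Σ ℕ λ q → 0 < p × 0 < q ×
    (∀ (n d : ℕ) → 1 ≤ n → 1 ≤ d → (G : Graph n) → Regular G d →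
    ¬ ContainsSubgraph G H →
    Σ ℕ λ k → HasInducedMatchingOfSize G k × (p * n * ⌊log₂ d ⌋ ≤ q * d * k))
-- The constant c is 1/(256 K), which depends on H only through B. Rounding the binary logarithm
-- down costs at most a factor two for d ≥ 2, and for d = 1 the logarithm vanishes.
theorem2 {B} H 2<B bip = 1 , 256 * K , s≤s z≤n , ≤-trans (>-nonZero⁻¹ K) (m≤n*m K 256) ,
  λ n d _ d≥1 G regular H-free → map₂
    (map₂ (≤-trans (≤-reflexive (cong (_* ⌊log₂ d ⌋) (*-identityˡ n)))))
    (matching-bound H (<-trans (s≤s z≤n) 2<B) bip γ (proj₂ (exponent (4 * (68 + 32 * B)))) K refl
      n d d≥1 G regular H-free)
  where
  γ = proj₁ (exponent (4 * (68 + 32 * B)))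
  K = (4 + γ) * suc B
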